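{- Let $w_1,w_2,w_3$ be any odd positive integers. Then for every integer $n\ge 0$ and all $y_1,y_2\in\mathbb{Z}_p$, the following six expressions are equal: \begin{align*} &w_1^n\sum_{k=0}^{n}\binom{n}{k}E_{k,\chi}(w_3y_1)\sum_{a=0}^{w_1d-1}(-1)^a\chi(a)E_{n-k,\chi}\Big(w_2y_2+\frac{w_2}{w_1}a\Big)w_3^{n-k}w_2^k\\ =&w_1^n\sum_{k=0}^{n}\binom{n}{k}E_{k,\chi}(w_2y_1)\sum_{a=0}^{w_1d-1}(-1)^a\chi(a)E_{n-k,\chi}\Big(w_3y_2+\frac{w_3}{w_1}a\Big)w_2^{n-k}w_3^k\\ =&w_2^n\sum_{k=0}^{n}\binom{n}{k}E_{k,\chi}(w_3y_1)\sum_{a=0}^{w_2d-1}(-1)^a\chi(a)E_{n-k,\chi}\Big(w_1y_2+\frac{w_1}{w_2}a\Big)w_3^{n-k}w_1^k\\ =&w_2^n\sum_{k=0}^{n}\binom{n}{k}E_{k,\chi}(w_1y_1)\sum_{a=0}^{w_2d-1}(-1)^a\chi(a)E_{n-k,\chi}\Big(w_3y_2+\frac{w_3}{w_2}a\Big)w_1^{n-k}w_3^k\\ =&w_3^n\sum_{k=0}^{n}\binom{n}{k}E_{k,\chi}(w_2y_1)\sum_{a=0}^{w_3d-1}(-1)^a\chi(a)E_{n-k,\chi}\Big(w_1y_2+\frac{w_1}{w_3}a\Big)w_2^{n-k}w_1^k\\ =&w_3^n\sum_{k=0}^{n}\binom{n}{k}E_{k,\chi}(w_1y_1)\sum_{a=0}^{w_3d-1}(-1)^a\chi(a)E_{n-k,\chi}\Big(w_2y_2+\frac{w_2}{w_3}a\Big)w_1^{n-k}w_2^k.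 \end{align*}
   Context: $p$ is a fixed odd prime, $\mathbb{Z}_p$ is the ring of $p$-adic integers, and $\mathbb{C}_p$ is the completion of an algebraic closure of $\mathbb{Q}_p$. $d$ is a fixed odd positive integer and $\chi$ is a (primitive) Dirichlet character of conductor $d$, with values in $\overline{\mathbb{Q}}$, regarded as $\mathbb{C}_p$-valued through a fixed embedding $\overline{\mathbb{Q}}\to\mathbb{C}_p$; as usual $\chi(a)=0$ when $\gcd(a,d)>1$ (and $\chi\equiv 1$ if $d=1$). The generalized Euler polynomials $E_{n,\chi}(x)$ attached to $\chi$ are the polynomials in $x$ (with coefficients in $\mathbb{C}_p$, so they can be evaluated at any element of $\mathbb{C}_p$) defined by $$\frac{2e^{xt}}{e^{dt}+1}\sum_{a=0}^{d-1}(-1)^a\chi(a)e^{at}=\sum_{n=0}^{\infty}E_{n,\chi}(x)\frac{t^n}{n!}.$$ -}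

module Defs where

open import Algebra.Apartness.Bundles using (HeytingField; HeytingCommutativeRing)
open import Algebra.Bundles using (CommutativeRing)
open import Algebra.Bundles.Raw using (RawRing)
import Algebra.Definitions.RawSemiring as RawSemiringDefinitions
open import Algebra.Morphism.Structures using (IsRingMonomorphism)
open import Data.Fin.Base using (toℕ)
open import Data.Integer.Base as ℤ using (ℤ; +_)
open import Data.Integer.Coprimality using (Coprime)
import Data.Integer.Divisibility.Signed as ℤ∣
import Data.Integer.Properties as ℤₚ
open import Data.Integer.Tactic.RingSolver using (solve-∀)
open import Data.List.Base using (List; []; _∷_; _∷ʳ_; map; foldr)
open import Data.Nat.Base as ℕ using (ℕ; zero; suc; _∸_; _!; NonZero)
open import Data.Nat.Combinatorics using (_C_)
import Data.Nat.Divisibility as ℕ∣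
open import Data.Nat.Properties using (_!≢0)
open import Data.Product.Base using (∃; ∃₂; _×_)
open import Data.Rational.Base as ℚ using (ℚ; 0ℚ; 1ℚ; ½)
open import Data.Rational.Properties using () renaming (heytingField to ℚ-heytingField)
open import Data.Vec.Base using (Vec; []; _∷_; lookup; head)
open import Function.Base using (_∘_)
open import Level using (Level; 0ℓ; _⊔_) renaming (suc to lsuc)
open import Relation.Binary.PropositionalEquality using (_≡_; subst; sym)
open import Relation.Nullary using (¬_)

private
  variable
    a b c ℓ ℓ₁ ℓ₂ c′ ℓ₁′ ℓ₂′ : Level

rawRing : HeytingField c ℓ₁ ℓ₂ → RawRing c ℓ₁
rawRing K = CommutativeRing.rawRing
  (HeytingCommutativeRing.commutativeRing (HeytingField.heytingCommutativeRing K))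

-- [ c₀ , c₁ , … ] stands for c₀ + c₁ X + …; trailing zeros are allowed,
-- and two lists are identified when all their coefficients agree.
module Polynomials (R : RawRing c ℓ) where
  open RawRing R

  Polynomial : Set c
  Polynomial = List Carrier

  coefficient : Polynomial → ℕ → Carrier
  coefficient []       _       = 0#
  coefficient (a ∷ _)  zero    = a
  coefficient (_ ∷ as) (suc n) = coefficient as n

  infix  4 _≈ₚ_
  infixl 6 _+ₚ_
  infixl 7 _*ₚ_

  _≈ₚ_ : Polynomial → Polynomial → Set ℓ
  f ≈ₚ g = ∀ n → coefficient f n ≈ coefficient g n

  constant : Carrier → Polynomial
  constant a = a ∷ []

  X : Polynomial
  X = 0# ∷ 1# ∷ []

  _+ₚ_ : Polynomial → Polynomial → Polynomial
  []       +ₚ g        = g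
  (a ∷ f)  +ₚ []       = a ∷ f
  (a ∷ f)  +ₚ (b ∷ g)  = a + b ∷ (f +ₚ g)

  _*ₚ_ : Polynomial → Polynomial → Polynomial
  []      *ₚ g = []
  (a ∷ f) *ₚ g = map (a *_) g +ₚ (0# ∷ f *ₚ g)

  eval : Polynomial → Carrier → Carrier
  eval f x = foldr (λ a r → a + x * r) 0# f

  polynomialRing : RawRing c ℓ
  polynomialRing = record
    { Carrier = Polynomial
    ; _≈_     = _≈ₚ_
    ; _+_     = _+ₚ_
    ; _*_     = _*ₚ_
    ; -_      = map (-_)
    ; 0#      = []
    ; 1#      = constant 1#
    }

-- A series f stands for f 0 + f 1 t + f 2 t² + …
module PowerSeries (R : RawRing c ℓ) where
  open RawRing R
  open RawSemiringDefinitions rawSemiring using (sum)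

  Series : Set c
  Series = ℕ → Carrier

  infixl 6 _⊕_
  infixl 7 _⊛_ _·_

  1ₛ : Series
  1ₛ zero    = 1#
  1ₛ (suc _) = 0#

  _⊕_ : Series → Series → Series
  (f ⊕ g) n = f n + g n

  _·_ : Carrier → Series → Series
  (a · f) n = a * f n

  _⊛_ : Series → Series → Series
  (f ⊛ g) n = sum {suc n} λ i → f (toℕ i) * g (n ∸ toℕ i)

  Σₛ : (n : ℕ) → (ℕ → Series) → Series
  Σₛ n f k = sum {n} λ i → f (toℕ i) k

  -- If u is the inverse of g 0, then `reciprocal u g` is the series r with
  -- g ⊛ r = 1ₛ, i.e. r 0 = u and
  --   r (n+1) = - u · (g 1 · r n + g 2 · r (n-1) + … + g (n+1) · r 0).
  -- `reciprocals u g n` lists r n, r (n-1), …, r 0.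
  reciprocals : Carrier → Series → (n : ℕ) → Vec Carrier (suc n)
  reciprocals u g zero    = u ∷ []
  reciprocals u g (suc n) =
    - (u * sum {suc n} (λ i → g (suc (toℕ i)) * lookup r i)) ∷ r
    where r = reciprocals u g n

  reciprocal : Carrier → Series → Series
  reciprocal u g n = head (reciprocals u g n)

-- Here R is to be a ℚ-algebra, with structure map fromℚ.
module GeneralizedEuler
  (R : RawRing c ℓ) (fromℚ : ℚ → RawRing.Carrier R)
  (d : ℕ) (χ : ℤ → RawRing.Carrier R)
  where
  open RawRing R
  open RawSemiringDefinitions rawSemiring using (sum; _^_)
  open Polynomials R
  open PowerSeries polynomialRing
  open RawSemiringDefinitions (RawRing.rawSemiring polynomialRing)
    using () renaming (_^_ to _^ₚ_)

  fromℕ : ℕ → Carrier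
  fromℕ n = fromℚ (+ n ℚ./ 1)

  signed : ℕ → Carrier
  signed a = (- 1#) ^ a * χ (+ a)

  -- The series e^{ft}, for f a polynomial in x.
  exp : Polynomial → Series
  exp f n = constant (fromℚ (ℚ._/_ (+ 1) (n !) {{n !≢0}})) *ₚ f ^ₚ n

  denominator : Series
  denominator = exp (constant (fromℕ d)) ⊕ 1ₛ

  numerator : Series
  numerator =
    (constant (fromℕ 2) · exp X)
      ⊛ Σₛ d (λ a → constant (signed a) · exp (constant (fromℕ a)))

  -- The constant term of the denominator is 2.
  generatingFunction : Series
  generatingFunction = numerator ⊛ reciprocal (constant (fromℚ ½)) denominator

  eulerPolynomial : ℕ → Polynomial
  eulerPolynomial n = constant (fromℕ (n !)) *ₚ generatingFunction n

  E : ℕ → Carrier → Carrier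
  E n x = eval (eulerPolynomial n) x

  --          n                        ud-1
  --   uⁿ ·   ∑  C(n,k) E_k(w y₁)  ·   ∑  (-1)ᵃ χ(a) E_{n-k}(v y₂ + (v/u) a) · wⁿ⁻ᵏ vᵏ
  --         k=0                       a=0
  eulerSum : (u v w : ℕ) .{{_ : NonZero u}} → ℕ → Carrier → Carrier → Carrier
  eulerSum u v w n y₁ y₂ =
    fromℕ u ^ n * sum {suc n} λ i → let k = toℕ i in
      fromℕ (n C k)
        * E k (fromℕ w * y₁)
        * (sum {u ℕ.* d} λ j → let a = toℕ j in
             signed a * E (n ∸ k) (fromℕ v * y₂ + fromℚ (+ v ℚ./ u) * fromℕ a))
        * fromℕ w ^ (n ∸ k)
        * fromℕ v ^ k

-- ℤ_p as the inverse limit of the rings ℤ/pⁿ.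
module PadicIntegers (p : ℕ) where

  infix 4 _≡_[mod-p^_]

  _≡_[mod-p^_] : ℤ → ℤ → ℕ → Set
  x ≡ y [mod-p^ n ] = (+ (p ℕ.^ n)) ℤ∣.∣ (x ℤ.- y)

  record ℤ-p : Set where
    field
      residue  : ℕ → ℤ
      coherent : ∀ n → residue (suc n) ≡ residue n [mod-p^ n ]

  open ℤ-p

  private
    +-regroup : ∀ x x′ y y′ →
      (x ℤ.- x′) ℤ.+ (y ℤ.- y′) ≡ (x ℤ.+ y) ℤ.- (x′ ℤ.+ y′)
    +-regroup = solve-∀

    *-regroup : ∀ x x′ y y′ →
      x ℤ.* (y ℤ.- y′) ℤ.+ (x ℤ.- x′) ℤ.* y′ ≡ (x ℤ.* y) ℤ.- (x′ ℤ.* y′)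
    *-regroup = solve-∀

    neg-regroup : ∀ x x′ → ℤ.- (x ℤ.- x′) ≡ (ℤ.- x) ℤ.- (ℤ.- x′)
    neg-regroup = solve-∀

  fromℤ : ℤ → ℤ-p
  fromℤ x .residue  _ = x
  fromℤ x .coherent n =
    subst (_ ℤ∣.∣_) (sym (ℤₚ.+-inverseʳ x)) (ℤ∣.divides ℤ.0ℤ _≡_.refl)

  infixl 6 _+ᶻ_
  infixl 7 _*ᶻ_

  _+ᶻ_ : ℤ-p → ℤ-p → ℤ-p
  (x +ᶻ y) .residue  n = residue x n ℤ.+ residue y n
  (x +ᶻ y) .coherent n = subst (_ ℤ∣.∣_)
    (+-regroup (residue x (suc n)) (residue x n) (residue y (suc n)) (residue y n))
    (ℤ∣.∣m∣n⇒∣m+n (coherent x n) (coherent y n))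

  _*ᶻ_ : ℤ-p → ℤ-p → ℤ-p
  (x *ᶻ y) .residue  n = residue x n ℤ.* residue y n
  (x *ᶻ y) .coherent n = subst (_ ℤ∣.∣_)
    (*-regroup (residue x (suc n)) (residue x n) (residue y (suc n)) (residue y n))
    (ℤ∣.∣m∣n⇒∣m+n (ℤ∣.∣n⇒∣m*n (residue x (suc n)) (coherent y n))
                  (ℤ∣.∣m⇒∣m*n (residue y n) (coherent x n)))

  -ᶻ_ : ℤ-p → ℤ-p
  (-ᶻ x) .residue  n = ℤ.- residue x n
  (-ᶻ x) .coherent n = subst (_ ℤ∣.∣_)
    (neg-regroup (residue x (suc n)) (residue x n)) (ℤ∣.∣m⇒∣-m (coherent x n))

  ℤ-p-ring : RawRing 0ℓ 0ℓ
  ℤ-p-ring = record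
    { Carrier = ℤ-p
    ; _≈_     = λ x y → ∀ n → residue x n ≡ residue y n [mod-p^ n ]
    ; _+_     = _+ᶻ_
    ; _*_     = _*ᶻ_
    ; -_      = -ᶻ_
    ; 0#      = fromℤ ℤ.0ℤ
    ; 1#      = fromℤ ℤ.1ℤ
    }

open PadicIntegers public using (ℤ-p; ℤ-p-ring)

record IsFractionField (R : RawRing a ℓ) (F : HeytingField c ℓ₁ ℓ₂)
                       (φ : RawRing.Carrier R → HeytingField.Carrier F)
                       : Set (a ⊔ ℓ ⊔ c ⊔ ℓ₁ ⊔ ℓ₂) where
  open HeytingField F
  field
    isRingMonomorphism : IsRingMonomorphism R (rawRing F) φ
    fraction           : ∀ x → ∃₂ λ r s → φ s # 0# × x * φ s ≈ φ r

-- A nonconstant monic polynomial is c ∷ cs ∷ʳ 1#.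
record IsAlgebraicClosure (F : HeytingField c ℓ₁ ℓ₂) (L : HeytingField c′ ℓ₁′ ℓ₂′)
                          (φ : HeytingField.Carrier F → HeytingField.Carrier L)
                          : Set (c ⊔ ℓ₁ ⊔ c′ ⊔ ℓ₁′) where
  open HeytingField L
  open Polynomials (rawRing L) using (eval)
  field
    isRingMonomorphism  : IsRingMonomorphism (rawRing F) (rawRing L) φ
    algebraic           : ∀ x → ∃₂ λ c cs → eval (map φ (c ∷ cs) ∷ʳ 1#) x ≈ 0#
    algebraicallyClosed : ∀ c cs → ∃ λ x → eval (c ∷ cs ∷ʳ 1#) x ≈ 0#

-- Rank-one valuations, written additively, with values in ℚ and v(0) = ∞ left out.
-- The absolute value is |x| = p^{-v(x)}; on ℂ_p its value group is p^ℚ.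
record Valuation (K : HeytingField c ℓ₁ ℓ₂) : Set (c ⊔ ℓ₁ ⊔ ℓ₂) where
  open HeytingField K
  field
    v      : ∀ x → x # 0# → ℚ
    v-cong : ∀ {x y} x# y# → x ≈ y → v x x# ≡ v y y#
    v-*    : ∀ {x y} x# y# xy# → v (x * y) xy# ≡ v x x# ℚ.+ v y y#
    v-+    : ∀ {x y} x# y# x+y# → (v x x# ℚ.⊓ v y y#) ℚ.≤ v (x + y) x+y#

  -- |x - y| ≤ p^{-q}
  Close : ℚ → Carrier → Carrier → Set ℓ₂
  Close q x y = ∀ x-y# → q ℚ.≤ v (x - y) x-y#

  Cauchy : (ℕ → Carrier) → Set ℓ₂
  Cauchy s = ∀ q → ∃ λ N → ∀ m n → N ℕ.≤ m → N ℕ.≤ n → Close q (s m) (s n)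

  _ConvergesTo_ : (ℕ → Carrier) → Carrier → Set ℓ₂
  s ConvergesTo x = ∀ q → ∃ λ N → ∀ n → N ℕ.≤ n → Close q (s n) x

record IsCompletion (L : HeytingField c ℓ₁ ℓ₂) (K : HeytingField c′ ℓ₁′ ℓ₂′)
                    (φ : HeytingField.Carrier L → HeytingField.Carrier K)
                    (val : Valuation K)
                    : Set (c ⊔ ℓ₁ ⊔ c′ ⊔ ℓ₁′ ⊔ ℓ₂′) where
  open Valuation val
  field
    isRingMonomorphism : IsRingMonomorphism (rawRing L) (rawRing K) φ
    dense              : ∀ x q → ∃ λ y → Close q (φ y) x
    complete           : ∀ s → Cauchy s → ∃ λ x → s ConvergesTo x

-- The tower ℤ_p ⊂ ℚ_p ⊂ ℚ̄_p ⊂ ℂ_p, each step given by its defining property.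
-- v-ℤ-p and v-p say that v extends the p-adic valuation of ℚ_p; its extension
-- to ℚ̄_p is unique, so this fixes the topology in which ℂ_p completes ℚ̄_p.
record CompletedAlgebraicClosure (p : ℕ) (c ℓ₁ ℓ₂ : Level) : Set (lsuc (c ⊔ ℓ₁ ⊔ ℓ₂)) where
  field
    ℚ-p ℚ̄-p ℂ-p : HeytingField c ℓ₁ ℓ₂

    ℤ-p→ℚ-p : ℤ-p p → HeytingField.Carrier ℚ-p
    ℚ-p→ℚ̄-p : HeytingField.Carrier ℚ-p → HeytingField.Carrier ℚ̄-p
    ℚ̄-p→ℂ-p : HeytingField.Carrier ℚ̄-p → HeytingField.Carrier ℂ-p

    isFractionField    : IsFractionField (ℤ-p-ring p) ℚ-p ℤ-p→ℚ-p
    isAlgebraicClosure : IsAlgebraicClosure ℚ-p ℚ̄-p ℚ-p→ℚ̄-p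
    valuation          : Valuation ℂ-p
    isCompletion       : IsCompletion ℚ̄-p ℂ-p ℚ̄-p→ℂ-p valuation

  ℤ-p→ℂ-p : ℤ-p p → HeytingField.Carrier ℂ-p
  ℤ-p→ℂ-p = ℚ̄-p→ℂ-p ∘ ℚ-p→ℚ̄-p ∘ ℤ-p→ℚ-p

  open HeytingField ℂ-p using (_#_; 0#)
  open Valuation valuation using (v)
  field
    v-ℤ-p : ∀ z z# → 0ℚ ℚ.≤ v (ℤ-p→ℂ-p z) z#
    v-p   : ∀ p# → v (ℤ-p→ℂ-p (PadicIntegers.fromℤ p (+ p))) p# ≡ 1ℚ

-- ℚ̄ together with an embedding into K.
record EmbeddedAlgebraicNumbers (c ℓ₁ ℓ₂ : Level) (K : HeytingField c′ ℓ₁′ ℓ₂′)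
                                : Set (lsuc (c ⊔ ℓ₁ ⊔ ℓ₂) ⊔ c′ ⊔ ℓ₁′) where
  field
    ℚ̄                  : HeytingField c ℓ₁ ℓ₂
    ℚ→ℚ̄                : ℚ → HeytingField.Carrier ℚ̄
    isAlgebraicClosure : IsAlgebraicClosure ℚ-heytingField ℚ̄ ℚ→ℚ̄
    embedding          : HeytingField.Carrier ℚ̄ → HeytingField.Carrier K
    isRingMonomorphism : IsRingMonomorphism (rawRing ℚ̄) (rawRing K) embedding

  -- ℚ has only one ring homomorphism to K, so this is the usual inclusion.
  fromℚ : ℚ → HeytingField.Carrier K
  fromℚ = embedding ∘ ℚ→ℚ̄

record DirichletCharacter (d : ℕ) (K : HeytingField c ℓ₁ ℓ₂) : Set (c ⊔ ℓ₁) where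
  open HeytingField K
  field
    χ        : ℤ → Carrier
    periodic : ∀ a b → + d ℤ∣.∣ a ℤ.- b → χ a ≈ χ b
    χ-1      : χ ℤ.1ℤ ≈ 1#
    χ-*      : ∀ a b → χ (a ℤ.* b) ≈ χ a * χ b
    χ-zero   : ∀ a → ¬ Coprime a (+ d) → χ a ≈ 0#

  InducedFrom : ℕ → Set ℓ₁
  InducedFrom m = ∀ a b → Coprime a (+ d) → Coprime b (+ d) →
                  + m ℤ∣.∣ a ℤ.- b → χ a ≈ χ b

  -- The conductor is d itself.
  Primitive : Set ℓ₁
  Primitive = ∀ m → m ℕ∣.∣ d → InducedFrom m → m ≡ d

{-# OPTIONS --safe #-}

-- For a ℚ-algebra R and x in R, ∑ Eₙ(x) tⁿ/n! = 2 e^{xt} H(t) with H = S/D, where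
-- S = ∑_{a<d} (-1)ᵃ χ(a) e^{at} and D = e^{dt} + 1.  Since d and u are odd, summing a
-- geometric progression gives ∑_{a<ud} (-1)ᵃ χ(a) e^{at} = (e^{udt} + 1) H(t).  Hence the
-- sums attached to (u, v, w), over all n, have the exponential generating function
--   4 e^{uvw(y₁+y₂)t} (e^{duvwt} + 1) H(uvt) H(uwt) H(vwt),
-- which is symmetric in u, v, w.
module Submission where

open import Defs
open import Algebra.Apartness.Bundles using (HeytingCommutativeRing; HeytingField)
open import Algebra.Bundles using (CommutativeRing; RawRing)
import Algebra.Definitions.RawSemiring as RawSemiringDefinitions
open import Algebra.Morphism.Construct.Composition using (isRingHomomorphism)
open import Algebra.Morphism.Structures using (IsRingHomomorphism; IsRingMonomorphism)
import Algebra.Properties.CommutativeSemigroup as CommutativeSemigroupProperties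
import Algebra.Properties.CommutativeSemiring.Binomial as Binomial
import Algebra.Properties.CommutativeSemiring.Exp as SemiringExp
import Algebra.Properties.Ring as RingProperties
import Algebra.Properties.Semiring.Mult as SemiringMult
import Algebra.Properties.Semiring.Sum as SemiringSum
import Algebra.Solver.Ring.NaturalCoefficients.Default as SemiringSolver
open import Data.Fin.Base using (Fin; zero; suc; toℕ)
open import Data.Fin.Properties using (toℕ≤pred[n])
open import Data.Integer.Base as ℤ using (ℤ; +_)
import Data.Integer.Divisibility.Signed as ℤ∣
import Data.Integer.Properties as ℤ
open import Data.Integer.Tactic.RingSolver using (solve-∀)
open import Data.List.Base using ([]; _∷_; map)
open import Data.Nat.Base as ℕ using (ℕ; zero; suc; _∸_; _!; _≤_; NonZero)
open import Data.Nat.Combinatorics using (_C_; nCk≡n!/k![n-k]!; k![n∸k]!∣n!)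
open import Data.Nat.Divisibility using (_∤_; ∣m∣n⇒∣m+n; ∣-refl; _∣0)
open import Data.Nat.DivMod using (m/n*n≡m)
open import Data.Nat.Primality using (Prime)
import Data.Nat.Properties as ℕ
open import Data.Product.Base using (_×_; _,_)
open import Data.Rational.Base as ℚ using (ℚ; ½; 1ℚ; fromℚᵘ)
import Data.Rational.Properties as ℚ
open import Data.Rational.Unnormalised.Base as ℚᵘ using (mkℚᵘ; *≡*)
import Data.Rational.Unnormalised.Properties as ℚᵘ
open import Data.Vec.Base using (lookup)
open import Function.Base using (_∘_; _$_)
open import Level using (Level)
open import Relation.Binary.PropositionalEquality as ≡ using (_≡_)
import Relation.Binary.Reasoning.Setoid as SetoidReasoning
open import Relation.Nullary using (contradiction)

-- The Euler polynomials are defined through a series whose coefficients are lists standing for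
-- polynomials in x: operations without ring laws. Evaluation at a point respects each operation, so
-- it is applied to the whole generating function at once, and all algebra takes place in series
-- over R, where the ring laws hold. The three copies of H come from three substitutions. The weight
-- uⁿ wⁿ⁻ᵏ vᵏ equals (uv)ᵏ (uw)ⁿ⁻ᵏ, so the outer sum is a convolution of a series in uvt with one in
-- uwt, and each brings a factor 2 and its own H. In the second series the argument v y₂ + (v/u) a
-- gets multiplied by uw, which clears the denominator and turns a into the exponent vwa. The sum
-- over a is thus the character sum at vwt, and the third H is what its geometric progression
-- leaves.

private
  variable
    a c ℓ ℓ′ : Level

-- The commutative ring of formal power series, substitutions and reciprocals.

module SeriesRing (R : CommutativeRing c ℓ) where
  open CommutativeRing R hiding (rawRing; zero)
  open PowerSeries (CommutativeRing.rawRing R) public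
  open RingProperties ring using (-‿distribʳ-*)
  open CommutativeSemigroupProperties +-commutativeSemigroup using (interchange)
  open CommutativeSemigroupProperties *-commutativeSemigroup using ()
    renaming (x∙yz≈y∙xz to *-x∙yz≈y∙xz)
  open SemiringExp commutativeSemiring using (_^_)
  open SemiringSum semiring using (sum; sum-cong-≋; *-distribˡ-sum)
  open SetoidReasoning setoid

  infix 4 _≋_
  _≋_ : Series → Series → Set ℓ
  f ≋ g = ∀ n → f n ≈ g n

  0ₛ : Series
  0ₛ _ = 0#

  ⊝_ : Series → Series
  (⊝ f) n = - f n

  tail : Series → Series
  tail f n = f (suc n)

  ⊛-cong : ∀ {f f′ g g′} → f ≋ f′ → g ≋ g′ → f ⊛ g ≋ f′ ⊛ g′
  ⊛-cong f≋f′ g≋g′ n =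
    sum-cong-≋ {suc n} λ i → *-cong (f≋f′ (toℕ i)) (g≋g′ (n ∸ toℕ i))

  ⊛-congˡ : ∀ f {g g′} → g ≋ g′ → f ⊛ g ≋ f ⊛ g′
  ⊛-congˡ f {g} {g′} = ⊛-cong {f} {f} {g} {g′} (λ _ → refl)

  ⊛-congʳ : ∀ f {g g′} → g ≋ g′ → g ⊛ f ≋ g′ ⊛ f
  ⊛-congʳ f {g} {g′} g≋g′ = ⊛-cong {g} {g′} {f} {f} g≋g′ (λ _ → refl)

  ·-⊛ : ∀ x f g → (x · f) ⊛ g ≋ x · (f ⊛ g)
  ·-⊛ x f g n = trans (sum-cong-≋ {suc n} λ i → *-assoc x (f (toℕ i)) (g (n ∸ toℕ i)))
                      (sym (*-distribˡ-sum {suc n} x λ i → f (toℕ i) * g (n ∸ toℕ i)))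

  -- By definition `(f ⊛ g) (suc n)` unfolds to `f 0 * g (suc n) + (tail f ⊛ g) n`. This and the
  -- next laws are therefore inductions on the index with `tail f` in place of `f`, without
  -- reindexing of finite sums.
  ⊛-distribʳ-⊕ : ∀ h f g → (f ⊕ g) ⊛ h ≋ (f ⊛ h) ⊕ (g ⊛ h)
  ⊛-distribʳ-⊕ h f g zero    = begin
    (f 0 + g 0) * h 0 + 0#                   ≈⟨ +-cong (distribʳ _ _ _) (sym (+-identityˡ 0#)) ⟩
    f 0 * h 0 + g 0 * h 0 + (0# + 0#)        ≈⟨ interchange _ _ _ _ ⟩
    f 0 * h 0 + 0# + (g 0 * h 0 + 0#)        ∎
  ⊛-distribʳ-⊕ h f g (suc n) = begin
    (f 0 + g 0) * h (suc n) + ((tail f ⊕ tail g) ⊛ h) n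
      ≈⟨ +-cong (distribʳ _ _ _) (⊛-distribʳ-⊕ h (tail f) (tail g) n) ⟩
    f 0 * h (suc n) + g 0 * h (suc n) + ((tail f ⊛ h) n + (tail g ⊛ h) n)
      ≈⟨ interchange _ _ _ _ ⟩
    (f ⊛ h) (suc n) + (g ⊛ h) (suc n) ∎

  -- The tail of `f ⊛ g` is `f 0 · tail g ⊕ tail f ⊛ g` by definition; distributivity splits it, and
  -- the induction hypothesis takes the part with `tail f`.
  ⊛-assoc : ∀ f g h → (f ⊛ g) ⊛ h ≋ f ⊛ (g ⊛ h)
  ⊛-assoc f g h zero    = +-congʳ $ begin
    (f 0 * g 0 + 0#) * h 0   ≈⟨ *-congʳ (+-identityʳ _) ⟩
    f 0 * g 0 * h 0          ≈⟨ *-assoc _ _ _ ⟩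
    f 0 * (g 0 * h 0)        ≈⟨ *-congˡ (+-identityʳ _) ⟨
    f 0 * (g 0 * h 0 + 0#)   ∎
  ⊛-assoc f g h (suc n) = begin
    (f 0 * g 0 + 0#) * h (suc n) + ((f 0 · tail g ⊕ tail f ⊛ g) ⊛ h) n
      ≈⟨ +-cong (trans (*-congʳ (+-identityʳ _)) (*-assoc _ _ _))
                (⊛-distribʳ-⊕ h (f 0 · tail g) (tail f ⊛ g) n) ⟩
    f 0 * (g 0 * h (suc n)) + (((f 0 · tail g) ⊛ h) n + ((tail f ⊛ g) ⊛ h) n)
      ≈⟨ +-congˡ (+-cong (·-⊛ (f 0) (tail g) h n) (⊛-assoc (tail f) g h n)) ⟩
    f 0 * (g 0 * h (suc n)) + (f 0 * (tail g ⊛ h) n + (tail f ⊛ (g ⊛ h)) n)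
      ≈⟨ +-assoc _ _ _ ⟨
    f 0 * (g 0 * h (suc n)) + f 0 * (tail g ⊛ h) n + (tail f ⊛ (g ⊛ h)) n
      ≈⟨ +-congʳ (distribˡ _ _ _) ⟨
    (f ⊛ (g ⊛ h)) (suc n) ∎

  -- Unfolding exposes only the term with `f 0`; commutativity also needs the term at the opposite
  -- end.
  ⊛-last : ∀ f g n → (f ⊛ g) (suc n) ≈ (f ⊛ tail g) n + f (suc n) * g 0
  ⊛-last f g zero    = +-cong (sym (+-identityʳ _)) (+-identityʳ _)
  ⊛-last f g (suc n) = begin
    f 0 * g (suc (suc n)) + (tail f ⊛ g) (suc n)
      ≈⟨ +-congˡ (⊛-last (tail f) g n) ⟩
    f 0 * g (suc (suc n)) + ((tail f ⊛ tail g) n + f (suc (suc n)) * g 0)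
      ≈⟨ +-assoc _ _ _ ⟨
    (f ⊛ tail g) (suc n) + f (suc (suc n)) * g 0 ∎

  ⊛-comm : ∀ f g → f ⊛ g ≋ g ⊛ f
  ⊛-comm f g zero    = +-congʳ (*-comm _ _)
  ⊛-comm f g (suc n) = begin
    f 0 * g (suc n) + (tail f ⊛ g) n   ≈⟨ +-comm _ _ ⟩
    (tail f ⊛ g) n + f 0 * g (suc n)   ≈⟨ +-cong (⊛-comm (tail f) g n) (*-comm _ _) ⟩
    (g ⊛ tail f) n + g (suc n) * f 0   ≈⟨ ⊛-last g f n ⟨
    (g ⊛ f) (suc n)                    ∎

  ⊛-zeroˡ : ∀ f → 0ₛ ⊛ f ≋ 0ₛ
  ⊛-zeroˡ f zero    = trans (+-congʳ (zeroˡ _)) (+-identityʳ _)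
  ⊛-zeroˡ f (suc n) = trans (+-cong (zeroˡ _) (⊛-zeroˡ f n)) (+-identityʳ _)

  ⊛-identityˡ : ∀ f → 1ₛ ⊛ f ≋ f
  ⊛-identityˡ f zero    = trans (+-identityʳ _) (*-identityˡ _)
  ⊛-identityˡ f (suc n) = trans (+-cong (*-identityˡ _) (⊛-zeroˡ f n)) (+-identityʳ _)

  seriesRing : CommutativeRing c ℓ
  seriesRing = record
    { Carrier = Series
    ; _≈_     = _≋_
    ; _+_     = _⊕_
    ; _*_     = _⊛_
    ; -_      = ⊝_
    ; 0#      = 0ₛ
    ; 1#      = 1ₛ
    ; isCommutativeRing = record
      { isRing = record
        { +-isAbelianGroup = record
          { isGroup = record
            { isMonoid = record
              { isSemigroup = record
                { isMagma = record
                  { isEquivalence = record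
                    { refl  = λ _ → refl
                    ; sym   = λ p n → sym (p n)
                    ; trans = λ p q n → trans (p n) (q n)
                    }
                  ; ∙-cong = λ p q n → +-cong (p n) (q n)
                  }
                ; assoc = λ f g h n → +-assoc _ _ _
                }
              ; identity = (λ f n → +-identityˡ _) , (λ f n → +-identityʳ _)
              }
            ; inverse = (λ f n → -‿inverseˡ _) , (λ f n → -‿inverseʳ _)
            ; ⁻¹-cong = λ p n → -‿cong (p n)
            }
          ; comm = λ f g n → +-comm _ _
          }
        ; *-cong     = ⊛-cong
        ; *-assoc    = ⊛-assoc
        ; *-identity = ⊛-identityˡ
                     , (λ f n → trans (⊛-comm f 1ₛ n) (⊛-identityˡ f n))
        ; distrib    = (λ f g h n → trans (⊛-comm f (g ⊕ h) n)
                                   (trans (⊛-distribʳ-⊕ f g h n)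
                                          (+-cong (⊛-comm g f n) (⊛-comm h f n))))
                     , ⊛-distribʳ-⊕
        }
      ; *-comm = ⊛-comm
      }
    }

  Σₛ-cong : ∀ m {f g : ℕ → Series} → (∀ i → f i ≋ g i) → Σₛ m f ≋ Σₛ m g
  Σₛ-cong m f≋g k = sum-cong-≋ {m} λ i → f≋g (toℕ i) k

  ⊛-distribˡ-Σₛ : ∀ m f (g : ℕ → Series) → f ⊛ Σₛ m g ≋ Σₛ m (λ i → f ⊛ g i)
  ⊛-distribˡ-Σₛ zero    f g n = trans (⊛-comm f 0ₛ n) (⊛-zeroˡ f n)
  ⊛-distribˡ-Σₛ (suc m) f g n =
    trans (S.distribˡ f (g 0) (Σₛ m (g ∘ suc)) n) (+-congˡ (⊛-distribˡ-Σₛ m f (g ∘ suc) n))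
    where module S = CommutativeRing seriesRing

  Σₛ-split : ∀ m n (f : ℕ → Series) →
             Σₛ (m ℕ.+ n) f ≋ Σₛ m f ⊕ Σₛ n (λ i → f (m ℕ.+ i))
  Σₛ-split zero    n f k = sym (+-identityˡ _)
  Σₛ-split (suc m) n f k =
    trans (+-congˡ (Σₛ-split m n (f ∘ suc) k)) (sym (+-assoc _ _ _))

  -- The substitution t ↦ x t.
  scale : Carrier → Series → Series
  scale x f n = x ^ n * f n

  scale-cong : ∀ x {f g} → f ≋ g → scale x f ≋ scale x g
  scale-cong x f≋g n = *-congˡ (f≋g n)

  scale-congˡ : ∀ {x y} f → x ≈ y → scale x f ≋ scale y f
  scale-congˡ f x≈y n = *-congʳ (SemiringExp.^-congˡ commutativeSemiring n x≈y)

  scale-1ₛ : ∀ x → scale x 1ₛ ≋ 1ₛ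
  scale-1ₛ x zero    = *-identityˡ _
  scale-1ₛ x (suc n) = zeroʳ _

  scale-⊕ : ∀ x f g → scale x (f ⊕ g) ≋ scale x f ⊕ scale x g
  scale-⊕ x f g n = distribˡ _ _ _

  scale-· : ∀ x y f → scale x (y · f) ≋ y · scale x f
  scale-· x y f n = *-x∙yz≈y∙xz _ _ _

  scale-Σₛ : ∀ x m (f : ℕ → Series) → scale x (Σₛ m f) ≋ Σₛ m (scale x ∘ f)
  scale-Σₛ x m f n = *-distribˡ-sum {m} _ _

  -- Up to associativity `tail (scale x f)` is `x · scale x (tail f)`, so in the induction one
  -- factor `x` is pulled out by `·-⊛`.
  scale-⊛ : ∀ x f g → scale x (f ⊛ g) ≋ scale x f ⊛ scale x g
  scale-⊛ x f g zero    = begin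
    1# * (f 0 * g 0 + 0#)             ≈⟨ *-identityˡ _ ⟩
    f 0 * g 0 + 0#                    ≈⟨ +-congʳ (*-cong (*-identityˡ _) (*-identityˡ _)) ⟨
    1# * f 0 * (1# * g 0) + 0#        ∎
  scale-⊛ x f g (suc n) = begin
    x * x ^ n * (f 0 * g (suc n) + (tail f ⊛ g) n)
      ≈⟨ distribˡ _ _ _ ⟩
    x * x ^ n * (f 0 * g (suc n)) + x * x ^ n * (tail f ⊛ g) n
      ≈⟨ +-cong (*-x∙yz≈y∙xz _ _ _) (*-assoc _ _ _) ⟩
    f 0 * (x * x ^ n * g (suc n)) + x * scale x (tail f ⊛ g) n
      ≈⟨ +-cong (*-congʳ (sym (*-identityˡ _))) (*-congˡ (scale-⊛ x (tail f) g n)) ⟩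
    1# * f 0 * (x * x ^ n * g (suc n)) + x * (scale x (tail f) ⊛ scale x g) n
      ≈⟨ +-congˡ (·-⊛ x (scale x (tail f)) (scale x g) n) ⟨
    1# * f 0 * (x * x ^ n * g (suc n)) + ((x · scale x (tail f)) ⊛ scale x g) n
      ≈⟨ +-congˡ (⊛-cong {f = tail (scale x f)} {g = scale x g} (λ k → *-assoc _ _ _) (λ _ → refl) n) ⟨
    (scale x f ⊛ scale x g) (suc n) ∎

  -- The vector holds the latest coefficient first. Hence the sum in the recursion, which pairs
  -- `g (suc i)` with position `i`, is a coefficient of the convolution of `tail g` with the
  -- reciprocal.
  reciprocals-lookup : ∀ u g n (i : Fin (suc n)) →
                       lookup (reciprocals u g n) i ≡ reciprocal u g (n ∸ toℕ i)
  reciprocals-lookup u g zero    zero    = ≡.refl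
  reciprocals-lookup u g (suc n) zero    = ≡.refl
  reciprocals-lookup u g (suc n) (suc i) = reciprocals-lookup u g n i

  ⊛-reciprocal : ∀ u g → g 0 * u ≈ 1# → g ⊛ reciprocal u g ≋ 1ₛ
  ⊛-reciprocal u g g₀u≈1 zero    = trans (+-identityʳ _) g₀u≈1
  ⊛-reciprocal u g g₀u≈1 (suc n) = begin
    g 0 * - (u * s) + s′   ≈⟨ +-cong (sym (-‿distribʳ-* _ _)) s′≈s ⟩
    - (g 0 * (u * s)) + s  ≈⟨ +-congʳ (-‿cong (*-assoc _ _ _)) ⟨
    - (g 0 * u * s) + s    ≈⟨ +-congʳ (-‿cong (trans (*-congʳ g₀u≈1) (*-identityˡ s))) ⟩
    - s + s                ≈⟨ -‿inverseˡ s ⟩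
    0#                     ∎
    where
    s s′ : Carrier
    s  = sum {suc n} λ i → g (suc (toℕ i)) * lookup (reciprocals u g n) i
    s′ = (tail g ⊛ reciprocal u g) n
    s′≈s : s′ ≈ s
    s′≈s = sum-cong-≋ {suc n} λ i →
      *-congˡ {g (suc (toℕ i))} (reflexive (≡.sym (reciprocals-lookup u g n i)))

-- Ring homomorphisms applied to series coefficientwise.

module SeriesHomomorphism
  (A : RawRing a ℓ′) (R : CommutativeRing c ℓ)
  {h : RawRing.Carrier A → CommutativeRing.Carrier R}
  (isHomomorphism : IsRingHomomorphism A (CommutativeRing.rawRing R) h)
  where
  open CommutativeRing R hiding (rawRing; zero)
  open SeriesRing R
  open SemiringSum semiring using (sum; sum-cong-≋)
  open SemiringExp commutativeSemiring using (_^_)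
  open IsRingHomomorphism isHomomorphism
  private
    module A = RawRing A
    module AD = RawSemiringDefinitions A.rawSemiring
    module AS = PowerSeries A

  sum-homo : ∀ n (f : Fin n → A.Carrier) → h (AD.sum f) ≈ sum (h ∘ f)
  sum-homo zero    f = 0#-homo
  sum-homo (suc n) f = trans (+-homo _ _) (+-congˡ (sum-homo n (f ∘ suc)))

  ^-homo : ∀ x n → h (x AD.^ n) ≈ h x ^ n
  ^-homo x zero    = 1#-homo
  ^-homo x (suc n) = trans (*-homo _ _) (*-congˡ (^-homo x n))

  1ₛ-homo : h ∘ AS.1ₛ ≋ 1ₛ
  1ₛ-homo zero    = 1#-homo
  1ₛ-homo (suc n) = 0#-homo

  ⊛-homo : ∀ f g → h ∘ (f AS.⊛ g) ≋ (h ∘ f) ⊛ (h ∘ g)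
  ⊛-homo f g n = trans (sum-homo (suc n) λ i → f (toℕ i) A.* g (n ∸ toℕ i))
                       (sum-cong-≋ {suc n} λ i → *-homo (f (toℕ i)) (g (n ∸ toℕ i)))

  -- Stated for every position of the vector, because the next coefficient depends on all the
  -- earlier ones.
  reciprocals-homo : ∀ u g n i →
    h (lookup (AS.reciprocals u g n) i) ≈ lookup (reciprocals (h u) (h ∘ g) n) i
  reciprocals-homo u g zero    zero    = refl
  reciprocals-homo u g (suc n) zero    =
    trans (-‿homo _) (-‿cong (trans (*-homo _ _) (*-congˡ (trans
      (sum-homo (suc n) λ i → g (suc (toℕ i)) A.* lookup (AS.reciprocals u g n) i)
      (sum-cong-≋ {suc n} λ i →
        trans (*-homo (g (suc (toℕ i))) _) (*-congˡ (reciprocals-homo u g n i)))))))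
  reciprocals-homo u g (suc n) (suc i) = reciprocals-homo u g n i

  reciprocal-homo : ∀ u g → h ∘ AS.reciprocal u g ≋ reciprocal (h u) (h ∘ g)
  reciprocal-homo u g zero    = refl
  reciprocal-homo u g (suc n) = reciprocals-homo u g (suc n) zero

-- Evaluation of polynomials at a point.

module Evaluation (R : CommutativeRing c ℓ) (x : CommutativeRing.Carrier R) where
  open CommutativeRing R hiding (rawRing; zero)
  open Polynomials (CommutativeRing.rawRing R)
  open RingProperties ring using (-‿distribʳ-*; -‿+-comm; -0#≈0#)
  open CommutativeSemigroupProperties +-commutativeSemigroup using (interchange)
  open CommutativeSemigroupProperties *-commutativeSemigroup using (x∙yz≈y∙xz)
  open SetoidReasoning setoid

  private
    ev : Polynomial → Carrier
    ev f = eval f x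

  eval-constant : ∀ a → ev (constant a) ≈ a
  eval-constant a = trans (+-congˡ (zeroʳ x)) (+-identityʳ a)

  eval-X : ev X ≈ x
  eval-X = begin
    0# + x * ev (constant 1#)   ≈⟨ +-identityˡ _ ⟩
    x * ev (constant 1#)        ≈⟨ *-congˡ (eval-constant 1#) ⟩
    x * 1#                      ≈⟨ *-identityʳ x ⟩
    x                           ∎

  -- Trailing zeros let lists of different lengths be equal, so `eval-cong` has to compare a
  -- nonempty list with the empty one.
  eval-zero : ∀ f → f ≈ₚ [] → ev f ≈ 0#
  eval-zero []      f≈0 = refl
  eval-zero (a ∷ f) f≈0 = begin
    a + x * ev f  ≈⟨ +-cong (f≈0 0) (*-congˡ (eval-zero f (f≈0 ∘ suc))) ⟩
    0# + x * 0#   ≈⟨ trans (+-identityˡ _) (zeroʳ x) ⟩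
    0#            ∎

  eval-cong : ∀ f g → f ≈ₚ g → ev f ≈ ev g
  eval-cong []      g       f≈g = sym (eval-zero g (sym ∘ f≈g))
  eval-cong (a ∷ f) []      f≈g = eval-zero (a ∷ f) f≈g
  eval-cong (a ∷ f) (b ∷ g) f≈g = +-cong (f≈g 0) (*-congˡ (eval-cong f g (f≈g ∘ suc)))

  eval-+ : ∀ f g → ev (f +ₚ g) ≈ ev f + ev g
  eval-+ []      g       = sym (+-identityˡ _)
  eval-+ (a ∷ f) []      = sym (+-identityʳ _)
  eval-+ (a ∷ f) (b ∷ g) = begin
    a + b + x * ev (f +ₚ g)          ≈⟨ +-congˡ (*-congˡ (eval-+ f g)) ⟩
    a + b + x * (ev f + ev g)        ≈⟨ +-congˡ (distribˡ _ _ _) ⟩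
    a + b + (x * ev f + x * ev g)    ≈⟨ interchange _ _ _ _ ⟩
    a + x * ev f + (b + x * ev g)    ∎

  eval-map-* : ∀ a f → ev (map (a *_) f) ≈ a * ev f
  eval-map-* a []      = sym (zeroʳ a)
  eval-map-* a (b ∷ f) = begin
    a * b + x * ev (map (a *_) f)  ≈⟨ +-congˡ (*-congˡ (eval-map-* a f)) ⟩
    a * b + x * (a * ev f)         ≈⟨ +-congˡ (x∙yz≈y∙xz x a (ev f)) ⟩
    a * b + a * (x * ev f)         ≈⟨ distribˡ _ _ _ ⟨
    a * (b + x * ev f)             ∎

  eval-* : ∀ f g → ev (f *ₚ g) ≈ ev f * ev g
  eval-* []      g = sym (zeroˡ _)
  eval-* (a ∷ f) g = begin
    ev (map (a *_) g +ₚ (0# ∷ f *ₚ g))       ≈⟨ eval-+ (map (a *_) g) (0# ∷ f *ₚ g) ⟩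
    ev (map (a *_) g) + (0# + x * ev (f *ₚ g)) ≈⟨ +-cong (eval-map-* a g) (+-identityˡ _) ⟩
    a * ev g + x * ev (f *ₚ g)               ≈⟨ +-congˡ (*-congˡ (eval-* f g)) ⟩
    a * ev g + x * (ev f * ev g)             ≈⟨ +-congˡ (*-assoc _ _ _) ⟨
    a * ev g + x * ev f * ev g               ≈⟨ distribʳ _ _ _ ⟨
    (a + x * ev f) * ev g                    ∎

  eval-neg : ∀ f → ev (map (-_) f) ≈ - ev f
  eval-neg []      = sym -0#≈0#
  eval-neg (a ∷ f) = begin
    - a + x * ev (map (-_) f)   ≈⟨ +-congˡ (*-congˡ (eval-neg f)) ⟩
    - a + x * - ev f            ≈⟨ +-congˡ (-‿distribʳ-* x (ev f)) ⟨
    - a + - (x * ev f)          ≈⟨ -‿+-comm _ _ ⟩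
    - (a + x * ev f)            ∎

  eval-isRingHomomorphism : IsRingHomomorphism polynomialRing (CommutativeRing.rawRing R) ev
  eval-isRingHomomorphism = record
    { isSemiringHomomorphism = record
      { isNearSemiringHomomorphism = record
        { +-isMonoidHomomorphism = record
          { isMagmaHomomorphism = record
            { isRelHomomorphism = record { cong = λ {f} {g} → eval-cong f g }
            ; homo              = eval-+
            }
          ; ε-homo = refl
          }
        ; *-homo = eval-*
        }
      ; 1#-homo = eval-constant 1#
      }
    ; -‿homo = eval-neg
    }

-- Binomial coefficients and fractions.

nCk*k!*[n∸k]!≡n! : ∀ {n k} → k ≤ n → (n C k) ℕ.* (k ! ℕ.* (n ∸ k) !) ≡ n !
nCk*k!*[n∸k]!≡n! {n} {k} k≤n = ≡.trans
  (≡.cong (ℕ._* (k ! ℕ.* (n ∸ k) !)) (nCk≡n!/k![n-k]! k≤n))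
  (m/n*n≡m (k![n∸k]!∣n! k≤n))
  where instance _ = k ℕ.!* (n ∸ k) !≢0

-- A quotient `i / n` is `fromℚᵘ` of an unreduced fraction by definition. Once `fromℚᵘ` respects the
-- operations, identities between quotients are checked by cross-multiplication and no gcd appears.
fromℚᵘ-homo-+ : ∀ p q → fromℚᵘ (p ℚᵘ.+ q) ≡ fromℚᵘ p ℚ.+ fromℚᵘ q
fromℚᵘ-homo-+ p q = ℚ.toℚᵘ-injective $
  ℚᵘ.≃-trans (ℚ.toℚᵘ-fromℚᵘ (p ℚᵘ.+ q)) $ ℚᵘ.≃-sym $
  ℚᵘ.≃-trans (ℚ.toℚᵘ-homo-+ (fromℚᵘ p) (fromℚᵘ q))
             (ℚᵘ.+-cong (ℚ.toℚᵘ-fromℚᵘ p) (ℚ.toℚᵘ-fromℚᵘ q))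

fromℚᵘ-homo-* : ∀ p q → fromℚᵘ (p ℚᵘ.* q) ≡ fromℚᵘ p ℚ.* fromℚᵘ q
fromℚᵘ-homo-* p q = ℚ.toℚᵘ-injective $
  ℚᵘ.≃-trans (ℚ.toℚᵘ-fromℚᵘ (p ℚᵘ.* q)) $ ℚᵘ.≃-sym $
  ℚᵘ.≃-trans (ℚ.toℚᵘ-homo-* (fromℚᵘ p) (fromℚᵘ q))
             (ℚᵘ.*-cong (ℚ.toℚᵘ-fromℚᵘ p) (ℚ.toℚᵘ-fromℚᵘ q))

/1-homo-+ : ∀ i j → (i ℤ.+ j) ℚ./ 1 ≡ i ℚ./ 1 ℚ.+ j ℚ./ 1
/1-homo-+ i j = ≡.trans
  (ℚ.fromℚᵘ-cong {mkℚᵘ (i ℤ.+ j) 0} {mkℚᵘ i 0 ℚᵘ.+ mkℚᵘ j 0}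
    (*≡* (≡.cong (ℤ._* ℤ.1ℤ) (≡.sym (≡.cong₂ ℤ._+_ (ℤ.*-identityʳ i) (ℤ.*-identityʳ j))))))
  (fromℚᵘ-homo-+ (mkℚᵘ i 0) (mkℚᵘ j 0))

/1-homo-* : ∀ i j → (i ℤ.* j) ℚ./ 1 ≡ i ℚ./ 1 ℚ.* (j ℚ./ 1)
/1-homo-* i j = fromℚᵘ-homo-* (mkℚᵘ i 0) (mkℚᵘ j 0)

n*[i/n]≡i/1 : ∀ i n .{{_ : NonZero n}} → (+ n ℚ./ 1) ℚ.* (i ℚ./ n) ≡ i ℚ./ 1
n*[i/n]≡i/1 i n@(suc k) = ≡.trans
  (≡.sym (fromℚᵘ-homo-* (mkℚᵘ (+ n) 0) (mkℚᵘ i k)))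
  (ℚ.fromℚᵘ-cong {mkℚᵘ (+ n) 0 ℚᵘ.* mkℚᵘ i k} {mkℚᵘ i 0} (*≡* (begin
    + n ℤ.* i ℤ.* + 1     ≡⟨ ℤ.*-identityʳ _ ⟩
    + n ℤ.* i             ≡⟨ ℤ.*-comm (+ n) i ⟩
    i ℤ.* + n             ≡⟨ ≡.cong (λ m → i ℤ.* + m) (ℕ.*-identityˡ n) ⟨
    i ℤ.* + (1 ℕ.* n)     ∎)))
  where open ≡.≡-Reasoning

-- Odd powers of -1 and geometric progressions in a commutative ring.

module OddPowers (R : CommutativeRing c ℓ) where
  open CommutativeRing R hiding (rawRing; zero)
  open RingProperties ring using (-1*x≈-x; -‿involutive)
  open SemiringExp commutativeSemiring using (_^_)

  -- Serves twice: with d for the sign change under a shift by one period, and with u for the last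
  -- power of the geometric progression.
  [-1]^odd≈-1 : ∀ n → 2 ∤ n → (- 1#) ^ n ≈ - 1#
  [-1]^odd≈-1 zero          2∤n = contradiction (2 ∣0) 2∤n
  [-1]^odd≈-1 (suc zero)    2∤n = *-identityʳ _
  [-1]^odd≈-1 (suc (suc n)) 2∤n =
    trans (-1*x≈-x _) (trans (-‿cong (-1*x≈-x _))
      (trans (-‿involutive _) ([-1]^odd≈-1 n (2∤n ∘ ∣m∣n⇒∣m+n ∣-refl))))

module GeometricSums (A : CommutativeRing c ℓ) where
  open CommutativeRing A hiding (rawRing; zero)
  open SemiringSolver commutativeSemiring
  open SetoidReasoning setoid

  inverse-unique : ∀ {x y z} → x * y ≈ 1# → x * z ≈ 1# → y ≈ z
  inverse-unique {x} {y} {z} xy≈1 xz≈1 = begin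
    y            ≈⟨ *-identityʳ y ⟨
    y * 1#       ≈⟨ *-congˡ xz≈1 ⟨
    y * (x * z)  ≈⟨ solve 3 (λ x y z → y :* (x :* z) := (x :* y) :* z) refl x y z ⟩
    x * y * z    ≈⟨ *-congʳ xy≈1 ⟩
    1# * z       ≈⟨ *-identityˡ z ⟩
    z            ∎

  -- The inductive step of (1 + b) · (s + (-b) s + … + (-b)ᵐ⁻¹ s) + (-b)ᵐ s = s,
  -- with n standing for -b.
  geometric-step : ∀ {b n s t t′ p p′} → b + n ≈ 0# → t′ ≈ s + n * t → p′ ≈ n * p →
                   t * (b + 1#) + p * s ≈ s → t′ * (b + 1#) + p′ * s ≈ s
  geometric-step {b} {n} {s} {t} {t′} {p} {p′} b+n≈0 t′≈ p′≈ ih = begin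
    t′ * (b + 1#) + p′ * s
      ≈⟨ +-cong (*-congʳ t′≈) (*-congʳ p′≈) ⟩
    (s + n * t) * (b + 1#) + n * p * s
      ≈⟨ solve 5 (λ b n s t p → (s :+ n :* t) :* (b :+ con 1) :+ n :* p :* s
               := s :* (b :+ con 1) :+ n :* (t :* (b :+ con 1) :+ p :* s)) refl b n s t p ⟩
    s * (b + 1#) + n * (t * (b + 1#) + p * s)
      ≈⟨ +-congˡ (*-congˡ ih) ⟩
    s * (b + 1#) + n * s
      ≈⟨ solve 3 (λ b n s → s :* (b :+ con 1) :+ n :* s := s :+ (b :+ n) :* s) refl b n s ⟩
    s + (b + n) * s
      ≈⟨ +-congˡ (trans (*-congʳ b+n≈0) (zeroˡ s)) ⟩
    s + 0#
      ≈⟨ +-identityʳ s ⟩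
    s ∎

  -- Unlike in `geometric-step`, `b` is now the whole denominator and `h` the quotient of `s` by it.
  -- As `p` is -`q`, the second hypothesis gives `t * b ≈ (q + 1#) * s ≈ (q + 1#) * h * b`, and the
  -- invertible `b` cancels.
  geometric-odd : ∀ {b t s p q h} → p + q ≈ 0# → t * b + p * s ≈ s → h * b ≈ s →
                  ∀ {b⁻¹} → b * b⁻¹ ≈ 1# → t ≈ (q + 1#) * h
  geometric-odd {b} {t} {s} {p} {q} {h} p+q≈0 tb+ps≈s hb≈s {b⁻¹} bb⁻¹≈1 = begin
    t                          ≈⟨ *-identityʳ t ⟨
    t * 1#                     ≈⟨ *-congˡ bb⁻¹≈1 ⟨
    t * (b * b⁻¹)              ≈⟨ *-assoc t b b⁻¹ ⟨
    t * b * b⁻¹                ≈⟨ *-congʳ tb≈ ⟩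
    (q + 1#) * h * b * b⁻¹     ≈⟨ *-assoc _ b b⁻¹ ⟩
    (q + 1#) * h * (b * b⁻¹)   ≈⟨ *-congˡ bb⁻¹≈1 ⟩
    (q + 1#) * h * 1#          ≈⟨ *-identityʳ _ ⟩
    (q + 1#) * h               ∎
    where
    tb≈ : t * b ≈ (q + 1#) * h * b
    tb≈ = begin
      t * b                            ≈⟨ +-identityʳ _ ⟨
      t * b + 0#                       ≈⟨ +-congˡ (trans (*-congʳ p+q≈0) (zeroˡ s)) ⟨
      t * b + (p + q) * s              ≈⟨ solve 4 (λ tb p q s → tb :+ (p :+ q) :* s
                                            := (tb :+ p :* s) :+ q :* s) refl (t * b) p q s ⟩
      t * b + p * s + q * s            ≈⟨ +-congʳ tb+ps≈s ⟩
      s + q * s                        ≈⟨ +-cong hb≈s (*-congˡ hb≈s) ⟨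
      h * b + q * (h * b)              ≈⟨ solve 3 (λ q h b → h :* b :+ q :* (h :* b)
                                            := (q :+ con 1) :* h :* b) refl q h b ⟩
      (q + 1#) * h * b                 ∎

-- Exponential series over a ℚ-algebra.

module Exponential
  (R : CommutativeRing c ℓ) {fromℚ : ℚ → CommutativeRing.Carrier R}
  (fromℚ-isHomomorphism : IsRingHomomorphism ℚ.+-*-rawRing (CommutativeRing.rawRing R) fromℚ)
  where
  open CommutativeRing R hiding (rawRing; zero)
  open SeriesRing R
  open SemiringExp commutativeSemiring using (_^_; ^-congˡ; ^-distrib-*)
  open SemiringSum semiring using (sum; sum-cong-≋; *-distribˡ-sum)
  open SemiringMult semiring using () renaming (_×_ to _×ₙ_)
  open Binomial commutativeSemiring using () renaming (theorem to binomial-theorem)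
  open SemiringSolver commutativeSemiring
  open SetoidReasoning setoid
  open IsRingHomomorphism fromℚ-isHomomorphism

  fromℕ : ℕ → Carrier
  fromℕ n = fromℚ (+ n ℚ./ 1)

  1/_! : ℕ → Carrier
  1/ n ! = fromℚ (ℚ._/_ (+ 1) (n !) {{n ℕ.!≢0}})

  fromℕ-homo-+ : ∀ m n → fromℕ (m ℕ.+ n) ≈ fromℕ m + fromℕ n
  fromℕ-homo-+ m n =
    trans (reflexive (≡.cong fromℚ (/1-homo-+ (+ m) (+ n)))) (+-homo _ _)

  fromℕ-homo-* : ∀ m n → fromℕ (m ℕ.* n) ≈ fromℕ m * fromℕ n
  fromℕ-homo-* m n = trans
    (reflexive (≡.cong fromℚ (≡.trans (≡.cong (ℚ._/ 1) (ℤ.pos-* m n)) (/1-homo-* (+ m) (+ n)))))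
    (*-homo _ _)

  fromℕ-*-/ : ∀ m n .{{_ : NonZero n}} → fromℕ n * fromℚ (+ m ℚ./ n) ≈ fromℕ m
  fromℕ-*-/ m n =
    trans (sym (*-homo _ _)) (reflexive (≡.cong fromℚ (n*[i/n]≡i/1 (+ m) n)))

  -- The binomial theorem counts by iterated addition, the Euler sums by `fromℕ`.
  ×ₙ≈fromℕ* : ∀ n x → n ×ₙ x ≈ fromℕ n * x
  ×ₙ≈fromℕ* zero    x = sym (trans (*-congʳ 0#-homo) (zeroˡ x))
  ×ₙ≈fromℕ* (suc n) x = begin
    x + n ×ₙ x              ≈⟨ +-cong (sym (*-identityˡ x)) (×ₙ≈fromℕ* n x) ⟩
    1# * x + fromℕ n * x   ≈⟨ distribʳ x 1# (fromℕ n) ⟨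
    (1# + fromℕ n) * x     ≈⟨ *-congʳ (+-congʳ 1#-homo) ⟨
    (fromℕ 1 + fromℕ n) * x ≈⟨ *-congʳ (fromℕ-homo-+ 1 n) ⟨
    fromℕ (suc n) * x      ∎

  n!*1/n!≈1 : ∀ n → fromℕ (n !) * 1/ n ! ≈ 1#
  n!*1/n!≈1 n = trans (fromℕ-*-/ 1 (n !) {{n ℕ.!≢0}}) 1#-homo

  nCk≈n!/k![n∸k]! : ∀ {n k} → k ≤ n →
    fromℕ (n C k) * (fromℕ (k !) * fromℕ ((n ∸ k) !)) ≈ fromℕ (n !)
  nCk≈n!/k![n∸k]! {n} {k} k≤n = begin
    fromℕ (n C k) * (fromℕ (k !) * fromℕ ((n ∸ k) !))
      ≈⟨ *-congˡ (fromℕ-homo-* (k !) ((n ∸ k) !)) ⟨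
    fromℕ (n C k) * fromℕ (k ! ℕ.* (n ∸ k) !)
      ≈⟨ fromℕ-homo-* (n C k) (k ! ℕ.* (n ∸ k) !) ⟨
    fromℕ ((n C k) ℕ.* (k ! ℕ.* (n ∸ k) !))
      ≡⟨ ≡.cong fromℕ (nCk*k!*[n∸k]!≡n! k≤n) ⟩
    fromℕ (n !) ∎

  -- Insert 1 as `fromℕ (n !) * 1/ n !` and expand n! as a binomial coefficient times k! (n-k)!; the
  -- two smaller factorials then meet their inverses.
  1/k!*1/[n∸k]!≈nCk/n! : ∀ {n k} → k ≤ n → 1/ k ! * 1/ (n ∸ k) ! ≈ 1/ n ! * fromℕ (n C k)
  1/k!*1/[n∸k]!≈nCk/n! {n} {k} k≤n = begin
    x * y                        ≈⟨ *-identityˡ _ ⟨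
    1# * (x * y)                 ≈⟨ *-congʳ (n!*1/n!≈1 n) ⟨
    fromℕ (n !) * z * (x * y)    ≈⟨ *-congʳ (*-congʳ (nCk≈n!/k![n∸k]! k≤n)) ⟨
    b * (fromℕ (k !) * fromℕ ((n ∸ k) !)) * z * (x * y)
      ≈⟨ solve 6 (λ x y z b p q → b :* (p :* q) :* z :* (x :* y)
               := z :* b :* ((p :* x) :* (q :* y))) refl x y z b _ _ ⟩
    z * b * (fromℕ (k !) * x * (fromℕ ((n ∸ k) !) * y))
      ≈⟨ *-congˡ (*-cong (n!*1/n!≈1 k) (n!*1/n!≈1 (n ∸ k))) ⟩
    z * b * (1# * 1#)            ≈⟨ *-congˡ (*-identityˡ 1#) ⟩
    z * b * 1#                   ≈⟨ *-identityʳ _ ⟩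
    z * b                        ∎
    where
    x y z b : Carrier
    x = 1/ k !
    y = 1/ (n ∸ k) !
    z = 1/ n !
    b = fromℕ (n C k)

  e^_t : Carrier → Series
  (e^ x t) n = 1/ n ! * x ^ n

  e-cong : ∀ {x y} → x ≈ y → e^ x t ≋ e^ y t
  e-cong x≈y n = *-congˡ (^-congˡ n x≈y)

  e-0 : ∀ {x} → x ≈ 0# → e^ x t ≋ 1ₛ
  e-0 x≈0 zero    = trans (*-identityʳ _) 1#-homo
  e-0 x≈0 (suc n) = trans (*-congˡ (trans (*-congʳ x≈0) (zeroˡ _))) (zeroʳ _)

  scale-e : ∀ x y → scale x (e^ y t) ≋ e^ x * y t
  scale-e x y n = trans
    (solve 3 (λ p q r → p :* (q :* r) := q :* (p :* r)) refl (x ^ n) (1/ n !) (y ^ n))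
    (*-congˡ (sym (^-distrib-* x y n)))

  -- Coefficientwise this is the binomial theorem divided by n!.
  e-+ : ∀ x y → e^ x + y t ≋ e^ x t ⊛ e^ y t
  e-+ x y n = begin
    1/ n ! * (x + y) ^ n
      ≈⟨ *-congˡ (binomial-theorem n x y) ⟩
    1/ n ! * sum {suc n} (λ i → (n C toℕ i) ×ₙ monomial i)
      ≈⟨ *-distribˡ-sum {suc n} (1/ n !) (λ i → (n C toℕ i) ×ₙ monomial i) ⟩
    sum {suc n} (λ i → 1/ n ! * ((n C toℕ i) ×ₙ monomial i))
      ≈⟨ sum-cong-≋ {suc n} term ⟩
    (e^ x t ⊛ e^ y t) n ∎
    where
    monomial : Fin (suc n) → Carrier
    monomial i = x ^ toℕ i * y ^ (n ∸ toℕ i)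
    term : ∀ i → 1/ n ! * ((n C toℕ i) ×ₙ monomial i) ≈
                 (e^ x t) (toℕ i) * (e^ y t) (n ∸ toℕ i)
    term i = begin
      1/ n ! * ((n C toℕ i) ×ₙ monomial i)
        ≈⟨ *-congˡ (×ₙ≈fromℕ* (n C toℕ i) (monomial i)) ⟩
      1/ n ! * (fromℕ (n C toℕ i) * monomial i)
        ≈⟨ *-assoc _ _ _ ⟨
      1/ n ! * fromℕ (n C toℕ i) * monomial i
        ≈⟨ *-congʳ (1/k!*1/[n∸k]!≈nCk/n! (toℕ≤pred[n] i)) ⟨
      1/ toℕ i ! * 1/ (n ∸ toℕ i) ! * monomial i
        ≈⟨ solve 4 (λ p q r s → p :* q :* (r :* s) := p :* r :* (q :* s)) refl
             (1/ toℕ i !) (1/ (n ∸ toℕ i) !) (x ^ toℕ i) (y ^ (n ∸ toℕ i)) ⟩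
      (e^ x t) (toℕ i) * (e^ y t) (n ∸ toℕ i) ∎

-- Alternating character sums and the quotient H.

module EulerSums
  (R : CommutativeRing c ℓ) {fromℚ : ℚ → CommutativeRing.Carrier R}
  (fromℚ-isHomomorphism : IsRingHomomorphism ℚ.+-*-rawRing (CommutativeRing.rawRing R) fromℚ)
  (d : ℕ) (2∤d : 2 ∤ d) (χ : ℤ → CommutativeRing.Carrier R)
  (χ-periodic : ∀ a → CommutativeRing._≈_ R (χ (+ (d ℕ.+ a))) (χ (+ a)))
  where
  open CommutativeRing R hiding (rawRing; zero)
  open Polynomials (CommutativeRing.rawRing R)
  open SeriesRing R
  open Exponential R fromℚ-isHomomorphism
  open OddPowers R
  open GeneralizedEuler (CommutativeRing.rawRing R) fromℚ d χ hiding (fromℕ)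
  open IsRingHomomorphism fromℚ-isHomomorphism
  open RawSemiringDefinitions (RawRing.rawSemiring polynomialRing)
    using () renaming (_^_ to _^ₚ_)
  open SemiringExp commutativeSemiring using (_^_; ^-congˡ; ^-homo-*; ^-distrib-*)
  open SemiringSum semiring using (sum; sum-cong-≋; *-distribˡ-sum)
  open SemiringSolver commutativeSemiring using (solve; _:*_; _:=_)
  open SetoidReasoning setoid
  private
    module S = CommutativeRing seriesRing
    module SS = SemiringSolver S.commutativeSemiring
    module SR = SetoidReasoning S.setoid
    module G = GeometricSums seriesRing

  characterSum : ℕ → Series
  characterSum n = Σₛ n λ a → signed a · e^ fromℕ a t

  -- `numeratorₑ`, `denominatorₑ` and `quotient` are S, D and H of the overview. In contrast to
  -- `numerator`, the factor 2 e^{xt} is left out of `numeratorₑ`, so that none of these series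
  -- depends on x.
  numeratorₑ denominatorₑ denominatorₑ⁻¹ quotient : Series
  numeratorₑ      = characterSum d
  denominatorₑ    = e^ fromℕ d t ⊕ 1ₛ
  denominatorₑ⁻¹  = reciprocal (fromℚ ½) denominatorₑ
  quotient        = numeratorₑ ⊛ denominatorₑ⁻¹

  denominatorₑ-0 : denominatorₑ 0 * fromℚ ½ ≈ 1#
  denominatorₑ-0 = begin
    (1/ 0 ! * 1# + 1#) * fromℚ ½   ≈⟨ *-congʳ (+-congʳ (trans (*-identityʳ _) 1#-homo)) ⟩
    (1# + 1#) * fromℚ ½            ≈⟨ distribʳ _ _ _ ⟩
    1# * fromℚ ½ + 1# * fromℚ ½    ≈⟨ +-cong (*-identityˡ _) (*-identityˡ _) ⟩
    fromℚ ½ + fromℚ ½              ≈⟨ +-homo ½ ½ ⟨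
    fromℚ 1ℚ                       ≈⟨ 1#-homo ⟩
    1#                             ∎

  denominatorₑ-inverse : denominatorₑ ⊛ denominatorₑ⁻¹ ≋ 1ₛ
  denominatorₑ-inverse = ⊛-reciprocal _ denominatorₑ denominatorₑ-0

  quotient⊛denominatorₑ : quotient ⊛ denominatorₑ ≋ numeratorₑ
  quotient⊛denominatorₑ = SR.begin
    numeratorₑ ⊛ denominatorₑ⁻¹ ⊛ denominatorₑ
      SR.≈⟨ SS.solve 3 (λ x y z → x SS.:* y SS.:* z SS.:= x SS.:* (z SS.:* y)) S.refl
              numeratorₑ denominatorₑ⁻¹ denominatorₑ ⟩
    numeratorₑ ⊛ (denominatorₑ ⊛ denominatorₑ⁻¹)
      SR.≈⟨ ⊛-congˡ numeratorₑ denominatorₑ-inverse ⟩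
    numeratorₑ ⊛ 1ₛ
      SR.≈⟨ S.*-identityʳ numeratorₑ ⟩
    numeratorₑ SR.∎

  ·-cong : ∀ {x y f g} → x ≈ y → f ≋ g → x · f ≋ y · g
  ·-cong x≈y f≋g n = *-cong x≈y (f≋g n)

  ·-⊛-· : ∀ x y f g → (x · f) ⊛ (y · g) ≋ (x * y) · (f ⊛ g)
  ·-⊛-· x y f g n = begin
    ((x · f) ⊛ (y · g)) n    ≈⟨ ·-⊛ x f (y · g) n ⟩
    x * (f ⊛ (y · g)) n      ≈⟨ *-congˡ (S.*-comm f (y · g) n) ⟩
    x * ((y · g) ⊛ f) n      ≈⟨ *-congˡ (·-⊛ y g f n) ⟩
    x * (y * (g ⊛ f) n)      ≈⟨ *-assoc _ _ _ ⟨
    x * y * (g ⊛ f) n        ≈⟨ *-congˡ (S.*-comm g f n) ⟩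
    x * y * (f ⊛ g) n        ∎

  -- Oddness of d enters here: a shift by d keeps χ and reverses the sign. Successive blocks of d
  -- terms of a character sum thus form a geometric progression of ratio -e^{dt}.
  signed-periodic : ∀ a → signed (d ℕ.+ a) ≈ - 1# * signed a
  signed-periodic a = begin
    (- 1#) ^ (d ℕ.+ a) * χ (+ (d ℕ.+ a))
      ≈⟨ *-cong (trans (^-homo-* (- 1#) d a) (*-congʳ ([-1]^odd≈-1 d 2∤d))) (χ-periodic a) ⟩
    - 1# * (- 1#) ^ a * χ (+ a)
      ≈⟨ *-assoc _ _ _ ⟩
    - 1# * signed a ∎

  -- The first block is split off, not the last, because `suc m ℕ.* d` reduces to `d ℕ.+ m ℕ.* d`.
  characterSum-suc : ∀ m →
    characterSum (suc m ℕ.* d) ≋ numeratorₑ ⊕ ((- 1# · e^ fromℕ d t) ⊛ characterSum (m ℕ.* d))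
  characterSum-suc m = SR.begin
    characterSum (d ℕ.+ m ℕ.* d)
      SR.≈⟨ Σₛ-split d (m ℕ.* d) (λ a → signed a · e^ fromℕ a t) ⟩
    numeratorₑ ⊕ Σₛ (m ℕ.* d) (λ a → signed (d ℕ.+ a) · e^ fromℕ (d ℕ.+ a) t)
      SR.≈⟨ S.+-congˡ (Σₛ-cong (m ℕ.* d) term) ⟩
    numeratorₑ ⊕ Σₛ (m ℕ.* d) (λ a → (- 1# · e^ fromℕ d t) ⊛ (signed a · e^ fromℕ a t))
      SR.≈⟨ S.+-congˡ (⊛-distribˡ-Σₛ (m ℕ.* d) (- 1# · e^ fromℕ d t)
                (λ a → signed a · e^ fromℕ a t)) ⟨
    numeratorₑ ⊕ ((- 1# · e^ fromℕ d t) ⊛ characterSum (m ℕ.* d)) SR.∎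
    where
    term : ∀ a → signed (d ℕ.+ a) · e^ fromℕ (d ℕ.+ a) t ≋
                 (- 1# · e^ fromℕ d t) ⊛ (signed a · e^ fromℕ a t)
    term a = S.trans
      (·-cong (signed-periodic a) (S.trans (e-cong (fromℕ-homo-+ d a)) (e-+ _ _)))
      (S.sym (·-⊛-· (- 1#) (signed a) (e^ fromℕ d t) (e^ fromℕ a t)))

  -- The geometric sum with its denominator cleared. Keeping the sign (-1)ᵐ makes it valid for every
  -- m, so the induction goes by single blocks and parity comes in only afterwards.
  characterSum-geometric : ∀ m →
    (characterSum (m ℕ.* d) ⊛ denominatorₑ) ⊕
      ((((- 1#) ^ m) · e^ fromℕ (m ℕ.* d) t) ⊛ numeratorₑ) ≋ numeratorₑ
  characterSum-geometric zero = SR.begin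
    (0ₛ ⊛ denominatorₑ) ⊕ ((1# · e^ fromℕ 0 t) ⊛ numeratorₑ)
      SR.≈⟨ S.+-cong (S.zeroˡ denominatorₑ)
              (⊛-congʳ numeratorₑ (λ n → trans (*-identityˡ _) (e-0 0#-homo n))) ⟩
    0ₛ ⊕ (1ₛ ⊛ numeratorₑ)
      SR.≈⟨ S.trans (S.+-identityˡ _) (S.*-identityˡ _) ⟩
    numeratorₑ SR.∎
  characterSum-geometric (suc m) = G.geometric-step
    {b = e^ fromℕ d t} { - 1# · e^ fromℕ d t} {numeratorₑ} {characterSum (m ℕ.* d)}
    {p = ((- 1#) ^ m) · e^ fromℕ (m ℕ.* d) t}
    (λ n → trans (+-cong (sym (*-identityˡ _)) refl)
             (trans (sym (distribʳ _ 1# (- 1#)))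
               (trans (*-congʳ (-‿inverseʳ 1#)) (zeroˡ _))))
    (characterSum-suc m)
    (S.trans (·-cong refl (S.trans (e-cong (fromℕ-homo-+ d (m ℕ.* d))) (e-+ _ _)))
             (S.sym (·-⊛-· (- 1#) ((- 1#) ^ m) (e^ fromℕ d t) (e^ fromℕ (m ℕ.* d) t))))
    (characterSum-geometric m)

  characterSum-odd : ∀ u → 2 ∤ u →
    characterSum (u ℕ.* d) ≋ (e^ fromℕ (u ℕ.* d) t ⊕ 1ₛ) ⊛ quotient
  characterSum-odd u 2∤u = G.geometric-odd
    {b = denominatorₑ} {characterSum (u ℕ.* d)} {numeratorₑ}
    {((- 1#) ^ u) · e^ fromℕ (u ℕ.* d) t} {e^ fromℕ (u ℕ.* d) t} {quotient}
    (λ n → trans (+-cong (*-congʳ ([-1]^odd≈-1 u 2∤u)) (sym (*-identityˡ _)))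
             (trans (sym (distribʳ _ (- 1#) 1#))
               (trans (*-congʳ (-‿inverseˡ 1#)) (zeroˡ _))))
    (characterSum-geometric u) quotient⊛denominatorₑ {denominatorₑ⁻¹} denominatorₑ-inverse

  -- ∑ₙ Eₙ(x) tⁿ/n!
  eulerSeries : Carrier → Series
  eulerSeries x = fromℕ 2 · (e^ x t ⊛ quotient)

  -- The generating function of the Euler polynomials, evaluated at a point.

  module _ (x : Carrier) where
    open Evaluation R x
    open SeriesHomomorphism polynomialRing R eval-isRingHomomorphism
    private
      ev : Polynomial → Carrier
      ev f = eval f x

    exp-homo : ∀ f → ev ∘ exp f ≋ e^ ev f t
    exp-homo f n = trans (eval-* (constant (1/ n !)) (f ^ₚ n)) (*-cong (eval-constant _) (^-homo f n))

    scaled-exp-homo : ∀ a b → (λ n → ev (constant a *ₚ exp b n)) ≋ a · e^ ev b t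
    scaled-exp-homo a b n = trans (eval-* (constant a) (exp b n)) (*-cong (eval-constant a) (exp-homo b n))

    numerator-homo : ev ∘ numerator ≋ (fromℕ 2 · e^ x t) ⊛ numeratorₑ
    numerator-homo = S.trans (⊛-homo (constant (fromℕ 2) ·ₚ exp X) (Σₚ d summand)) $ ⊛-cong
      (S.trans (scaled-exp-homo (fromℕ 2) X) (·-cong refl (e-cong eval-X)))
      (λ n → trans (sum-homo d (λ i → summand (toℕ i) n)) (sum-cong-≋ {d} λ i →
        trans (scaled-exp-homo (signed (toℕ i)) (constant (fromℕ (toℕ i))) n)
              (*-congˡ (e-cong (eval-constant _) n))))
      where
      open PowerSeries polynomialRing using () renaming (Series to Seriesₚ; _·_ to _·ₚ_; Σₛ to Σₚ)
      summand : ℕ → Seriesₚ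
      summand a = constant (signed a) ·ₚ exp (constant (fromℕ a))

    denominator-homo : ev ∘ denominator ≋ denominatorₑ
    denominator-homo n = trans (eval-+ (exp (constant (fromℕ d)) n) (1ₚ n))
      (+-cong (trans (exp-homo (constant (fromℕ d)) n) (e-cong (eval-constant _) n)) (1ₛ-homo n))
      where open PowerSeries polynomialRing using () renaming (1ₛ to 1ₚ)

    E≈n!*eulerSeries : ∀ n → E n x ≈ fromℕ (n !) * eulerSeries x n
    E≈n!*eulerSeries n = trans
      (eval-* (constant (fromℕ (n !))) (generatingFunction n))
      (*-cong (eval-constant _) (generatingFunction-homo n))
      where
      open PowerSeries polynomialRing using () renaming (reciprocal to reciprocalₚ)
      u : Polynomial
      u = constant (fromℚ ½)

      ev-inverse : denominatorₑ ⊛ reciprocal (ev u) (ev ∘ denominator) ≋ 1ₛ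
      ev-inverse = S.trans
        (⊛-congʳ (reciprocal (ev u) (ev ∘ denominator)) (S.sym denominator-homo))
        (⊛-reciprocal (ev u) (ev ∘ denominator)
          (trans (*-cong (denominator-homo 0) (eval-constant _)) denominatorₑ-0))

      -- Evaluation yields the reciprocal built from `ev u` and `ev ∘ denominator`, which agree with
      -- `fromℚ ½` and `denominatorₑ` only up to `≈`. Instead of comparing the two recursions, both
      -- results are recognised as inverses of `denominatorₑ`.
      reciprocal-denominator-homo : ev ∘ reciprocalₚ u denominator ≋ denominatorₑ⁻¹
      reciprocal-denominator-homo = S.trans (reciprocal-homo u denominator)
        (G.inverse-unique {denominatorₑ} {reciprocal (ev u) (ev ∘ denominator)} {denominatorₑ⁻¹}
          ev-inverse denominatorₑ-inverse)

      generatingFunction-homo : ev ∘ generatingFunction ≋ eulerSeries x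
      generatingFunction-homo = S.trans (⊛-homo numerator (reciprocalₚ u denominator)) $
        S.trans (⊛-cong numerator-homo reciprocal-denominator-homo) $
        S.trans (S.*-assoc (fromℕ 2 · e^ x t) numeratorₑ denominatorₑ⁻¹)
                (·-⊛ (fromℕ 2) (e^ x t) quotient)

  scale-eulerSeries : ∀ x y → scale x (eulerSeries y) ≋ fromℕ 2 · (e^ x * y t ⊛ scale x quotient)
  scale-eulerSeries x y = S.trans (scale-· x (fromℕ 2) (e^ y t ⊛ quotient)) $
    ·-cong refl (S.trans (scale-⊛ x (e^ y t) quotient) (⊛-congʳ (scale x quotient) (scale-e x y)))

  -- The symmetric generating function of the Euler sums.

  module _ (y₁ y₂ : Carrier) where

    -- Collects the factors that involve u, v, w only through the product `p`, so that their
    -- symmetry is just `prefactor-cong`. The two factors 2 make up the 4 of the overview.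
    prefactor : Carrier → Series
    prefactor p = (fromℕ 2 · e^ p * y₁ t) ⊛ ((fromℕ 2 · e^ p * y₂ t) ⊛ (e^ p * fromℕ d t ⊕ 1ₛ))

    -- The exponential generating function of the Euler sums for u = x, v = y, w = z.
    symmetricSeries : Carrier → Carrier → Carrier → Series
    symmetricSeries x y z = prefactor (x * y * z) ⊛
      (scale (x * y) quotient ⊛ (scale (x * z) quotient ⊛ scale (y * z) quotient))

    prefactor-cong : ∀ {p q} → p ≈ q → prefactor p ≋ prefactor q
    prefactor-cong p≈q = ⊛-cong (·-cong refl (e-cong (*-congʳ p≈q))) $
      ⊛-cong (·-cong refl (e-cong (*-congʳ p≈q))) (S.+-congʳ (e-cong (*-congʳ p≈q)))

    -- Exchanging `x` and `y` fixes the pairwise product `x * y` and exchanges the other two. With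
    -- `symmetricSeries-swapʳ` this generates all permutations.
    symmetricSeries-swapˡ : ∀ x y z → symmetricSeries x y z ≋ symmetricSeries y x z
    symmetricSeries-swapˡ x y z = ⊛-cong (prefactor-cong (*-congʳ (*-comm x y))) $
      ⊛-cong (scale-congˡ quotient (*-comm x y))
        (S.*-comm (scale (x * z) quotient) (scale (y * z) quotient))

    symmetricSeries-swapʳ : ∀ x y z → symmetricSeries x y z ≋ symmetricSeries x z y
    symmetricSeries-swapʳ x y z = ⊛-cong
      (prefactor-cong (solve 3 (λ x y z → x :* y :* z := x :* z :* y) refl x y z)) $
      S.trans (⊛-congˡ (scale (x * y) quotient) (⊛-congˡ (scale (x * z) quotient)
                (scale-congˡ quotient (*-comm y z))))
        (SS.solve 3 (λ f g h → f SS.:* (g SS.:* h) SS.:= g SS.:* (f SS.:* h)) S.refl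
          (scale (x * y) quotient) (scale (x * z) quotient) (scale (z * y) quotient))

    module _ (u v w : ℕ) .{{_ : NonZero u}} where
      private
        U V W : Carrier
        U = fromℕ u
        V = fromℕ v
        W = fromℕ w

        argument : ℕ → Carrier
        argument a = V * y₂ + fromℚ (+ v ℚ./ u) * fromℕ a

      innerSeries : Series
      innerSeries = Σₛ (u ℕ.* d) λ a → signed a · eulerSeries (argument a)

      -- Each E_k contributes k! times a series coefficient, so the binomial coefficient with k!
      -- (n-k)! becomes the common factor n!. The weights regroup as (UV)ᵏ (UW)ⁿ⁻ᵏ, which are the
      -- two scalings.
      eulerSum≈convolution : ∀ n → eulerSum u v w n y₁ y₂ ≈
        fromℕ (n !) * (scale (U * V) (eulerSeries (W * y₁)) ⊛ scale (U * W) innerSeries) n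
      eulerSum≈convolution n = begin
        eulerSum u v w n y₁ y₂
          ≈⟨ *-distribˡ-sum {suc n} (U ^ n) (λ i → fromℕ (n C toℕ i) * E (toℕ i) (W * y₁)
               * inner (n ∸ toℕ i) * W ^ (n ∸ toℕ i) * V ^ toℕ i) ⟩
        sum {suc n} (λ i → U ^ n * (fromℕ (n C toℕ i) * E (toℕ i) (W * y₁) * inner (n ∸ toℕ i)
                              * W ^ (n ∸ toℕ i) * V ^ toℕ i))
          ≈⟨ sum-cong-≋ {suc n} (λ i → term (toℕ i) (toℕ≤pred[n] i)) ⟩
        sum {suc n} (λ i → fromℕ (n !) * (f (toℕ i) * g (n ∸ toℕ i)))
          ≈⟨ *-distribˡ-sum {suc n} (fromℕ (n !)) (λ i → f (toℕ i) * g (n ∸ toℕ i)) ⟨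
        fromℕ (n !) * (f ⊛ g) n ∎
        where
        f g : Series
        f = scale (U * V) (eulerSeries (W * y₁))
        g = scale (U * W) innerSeries

        inner : ℕ → Carrier
        inner m = sum {u ℕ.* d} λ j → signed (toℕ j) * E m (argument (toℕ j))

        inner≈ : ∀ m → inner m ≈ fromℕ (m !) * innerSeries m
        inner≈ m = trans
          (sum-cong-≋ {u ℕ.* d} λ j → trans
            (*-congˡ (E≈n!*eulerSeries (argument (toℕ j)) m))
            (solve 3 (λ p q r → p :* (q :* r) := q :* (p :* r)) refl
              (signed (toℕ j)) (fromℕ (m !)) (eulerSeries (argument (toℕ j)) m)))
          (sym (*-distribˡ-sum {u ℕ.* d} (fromℕ (m !))
            λ j → signed (toℕ j) * eulerSeries (argument (toℕ j)) m))

        term : ∀ k → k ≤ n →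
          U ^ n * (fromℕ (n C k) * E k (W * y₁) * inner (n ∸ k) * W ^ (n ∸ k) * V ^ k)
            ≈ fromℕ (n !) * (f k * g (n ∸ k))
        term k k≤n = begin
          U ^ n * (fromℕ (n C k) * E k (W * y₁) * inner (n ∸ k) * W ^ (n ∸ k) * V ^ k)
            ≈⟨ *-cong Uⁿ≈ (*-congʳ (*-congʳ (*-cong
                 (*-congˡ (E≈n!*eulerSeries (W * y₁) k)) (inner≈ (n ∸ k))))) ⟩
          U ^ k * U ^ (n ∸ k) * (fromℕ (n C k) * (fromℕ (k !) * eulerSeries (W * y₁) k)
            * (fromℕ ((n ∸ k) !) * innerSeries (n ∸ k)) * W ^ (n ∸ k) * V ^ k)
            ≈⟨ solve 9 (λ U₁ U₂ V₁ W₂ b p q x y →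
                 U₁ :* U₂ :* (b :* (p :* x) :* (q :* y) :* W₂ :* V₁)
                   := b :* (p :* q) :* (U₁ :* V₁ :* x :* (U₂ :* W₂ :* y))) refl
                 (U ^ k) (U ^ (n ∸ k)) (V ^ k) (W ^ (n ∸ k)) (fromℕ (n C k))
                 (fromℕ (k !)) (fromℕ ((n ∸ k) !))
                 (eulerSeries (W * y₁) k) (innerSeries (n ∸ k)) ⟩
          fromℕ (n C k) * (fromℕ (k !) * fromℕ ((n ∸ k) !)) *
            (U ^ k * V ^ k * eulerSeries (W * y₁) k
              * (U ^ (n ∸ k) * W ^ (n ∸ k) * innerSeries (n ∸ k)))
            ≈⟨ *-cong (nCk≈n!/k![n∸k]! k≤n) (*-cong
                 (*-congʳ (sym (^-distrib-* U V k))) (*-congʳ (sym (^-distrib-* U W (n ∸ k))))) ⟩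
          fromℕ (n !) * (f k * g (n ∸ k)) ∎
          where
          Uⁿ≈ : U ^ n ≈ U ^ k * U ^ (n ∸ k)
          Uⁿ≈ = trans (reflexive (≡.cong (U ^_) (≡.sym (ℕ.m+[n∸m]≡n k≤n))))
                      (^-homo-* U k (n ∸ k))

      -- The factor `U` cancels the denominator of v/u; the coefficient `V * W` of a is the origin
      -- of the third scaling.
      scale-argument : ∀ a → U * W * argument a ≈ U * V * W * y₂ + V * W * fromℕ a
      scale-argument a = begin
        U * W * (V * y₂ + r * fromℕ a)
          ≈⟨ distribˡ _ _ _ ⟩
        U * W * (V * y₂) + U * W * (r * fromℕ a)
          ≈⟨ +-cong
               (solve 4 (λ U V W y → U :* W :* (V :* y) := U :* V :* W :* y) refl U V W y₂)
               (solve 4 (λ U W r a → U :* W :* (r :* a) := U :* r :* W :* a) refl U W r (fromℕ a)) ⟩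
        U * V * W * y₂ + U * r * W * fromℕ a
          ≈⟨ +-congˡ (*-congʳ (*-congʳ (fromℕ-*-/ v u))) ⟩
        U * V * W * y₂ + V * W * fromℕ a ∎
        where
        r : Carrier
        r = fromℚ (+ v ℚ./ u)

      -- Apart from its sign and character value, a term depends on a only through e^{vwat}. The
      -- remaining factor `K` leaves the sum, and what is left is a character sum at vwt, to which
      -- `characterSum-odd` applies.
      scale-innerSeries : 2 ∤ u → scale (U * W) innerSeries ≋
        ((fromℕ 2 · e^ U * V * W * y₂ t) ⊛ scale (U * W) quotient) ⊛
          ((e^ U * V * W * fromℕ d t ⊕ 1ₛ) ⊛ scale (V * W) quotient)
      scale-innerSeries 2∤u = SR.begin
        scale (U * W) innerSeries
          SR.≈⟨ scale-Σₛ (U * W) (u ℕ.* d) (λ a → signed a · eulerSeries (argument a)) ⟩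
        Σₛ (u ℕ.* d) (λ a → scale (U * W) (signed a · eulerSeries (argument a)))
          SR.≈⟨ Σₛ-cong (u ℕ.* d) term ⟩
        Σₛ (u ℕ.* d) (λ a → K ⊛ scale (V * W) (signed a · e^ fromℕ a t))
          SR.≈⟨ ⊛-distribˡ-Σₛ (u ℕ.* d) K (λ a → scale (V * W) (signed a · e^ fromℕ a t)) ⟨
        K ⊛ Σₛ (u ℕ.* d) (λ a → scale (V * W) (signed a · e^ fromℕ a t))
          SR.≈⟨ ⊛-congˡ K (scale-Σₛ (V * W) (u ℕ.* d) (λ a → signed a · e^ fromℕ a t)) ⟨
        K ⊛ scale (V * W) (characterSum (u ℕ.* d))
          SR.≈⟨ ⊛-congˡ K (scale-cong (V * W) (characterSum-odd u 2∤u)) ⟩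
        K ⊛ scale (V * W) ((e^ fromℕ (u ℕ.* d) t ⊕ 1ₛ) ⊛ quotient)
          SR.≈⟨ ⊛-congˡ K (scale-⊛ (V * W) (e^ fromℕ (u ℕ.* d) t ⊕ 1ₛ) quotient) ⟩
        K ⊛ (scale (V * W) (e^ fromℕ (u ℕ.* d) t ⊕ 1ₛ) ⊛ scale (V * W) quotient)
          SR.≈⟨ ⊛-congˡ K (⊛-congʳ (scale (V * W) quotient) scaled) ⟩
        K ⊛ ((e^ U * V * W * fromℕ d t ⊕ 1ₛ) ⊛ scale (V * W) quotient) SR.∎
        where
        Z K : Series
        Z = fromℕ 2 · e^ U * V * W * y₂ t
        K = Z ⊛ scale (U * W) quotient

        scaled : scale (V * W) (e^ fromℕ (u ℕ.* d) t ⊕ 1ₛ) ≋ e^ U * V * W * fromℕ d t ⊕ 1ₛ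
        scaled = S.trans (scale-⊕ (V * W) (e^ fromℕ (u ℕ.* d) t) 1ₛ) $
          S.+-cong (S.trans (scale-e (V * W) (fromℕ (u ℕ.* d))) (e-cong (trans
            (*-congˡ (fromℕ-homo-* u d))
            (solve 4 (λ U V W d → V :* W :* (U :* d) := U :* V :* W :* d) refl U V W (fromℕ d)))))
          (scale-1ₛ (V * W))

        term : ∀ a → scale (U * W) (signed a · eulerSeries (argument a)) ≋
                     K ⊛ scale (V * W) (signed a · e^ fromℕ a t)
        term a = SR.begin
          scale (U * W) (signed a · eulerSeries (argument a))
            SR.≈⟨ scale-· (U * W) (signed a) (eulerSeries (argument a)) ⟩
          signed a · scale (U * W) (eulerSeries (argument a))
            SR.≈⟨ ·-cong refl (scale-eulerSeries (U * W) (argument a)) ⟩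
          signed a · (fromℕ 2 · (e^ U * W * argument a t ⊛ scale (U * W) quotient))
            SR.≈⟨ ·-cong refl (·-cong refl (⊛-congʳ Q (S.trans
                    (e-cong (scale-argument a)) (e-+ _ _)))) ⟩
          signed a · (fromℕ 2 · (A ⊛ B ⊛ Q))
            -- Gathers 2, `A` and `Q`, which are free of a, into `K` and leaves `B` last.
            SR.≈⟨ (λ n → trans (*-congˡ (*-congˡ (S.*-assoc A B Q n)))
                    (trans (*-congˡ {signed a} (sym (·-⊛ (fromℕ 2) A (B ⊛ Q) n)))
                           (*-congˡ (S.trans (⊛-congˡ Z (S.*-comm B Q)) (S.sym (S.*-assoc Z Q B)) n)))) ⟩
          signed a · (K ⊛ B)
            SR.≈⟨ (λ n → trans (*-congˡ (S.*-comm K B n)) (trans (sym (·-⊛ (signed a) B K n))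
                    (S.*-comm (signed a · B) K n))) ⟩
          K ⊛ (signed a · B)
            SR.≈⟨ ⊛-congˡ K (S.trans (scale-· (V * W) (signed a) (e^ fromℕ a t))
                    (·-cong refl (scale-e (V * W) (fromℕ a)))) ⟨
          K ⊛ scale (V * W) (signed a · e^ fromℕ a t) SR.∎
          where
          A B Q : Series
          A = e^ U * V * W * y₂ t
          B = e^ V * W * fromℕ a t
          Q = scale (U * W) quotient

      eulerSum≈symmetricSeries : 2 ∤ u → ∀ n →
        eulerSum u v w n y₁ y₂ ≈ fromℕ (n !) * symmetricSeries U V W n
      eulerSum≈symmetricSeries 2∤u n =
        trans (eulerSum≈convolution n) (*-congˡ (convolution≋ n))
        where
        Y₁ Y₂ L Q₁ Q₂ Q₃ : Series
        Y₁ = fromℕ 2 · e^ U * V * W * y₁ t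
        Y₂ = fromℕ 2 · e^ U * V * W * y₂ t
        L  = e^ U * V * W * fromℕ d t ⊕ 1ₛ
        Q₁ = scale (U * V) quotient
        Q₂ = scale (U * W) quotient
        Q₃ = scale (V * W) quotient

        first : scale (U * V) (eulerSeries (W * y₁)) ≋ Y₁ ⊛ Q₁
        first = S.trans (scale-eulerSeries (U * V) (W * y₁)) $
          S.trans (S.sym (·-⊛ (fromℕ 2) (e^ U * V * (W * y₁) t) Q₁))
            (⊛-congʳ Q₁ (·-cong refl (e-cong (sym (*-assoc (U * V) W y₁)))))

        convolution≋ : scale (U * V) (eulerSeries (W * y₁)) ⊛ scale (U * W) innerSeries
                         ≋ symmetricSeries U V W
        convolution≋ = S.trans (⊛-cong first (scale-innerSeries 2∤u))
          (SS.solve 6 (λ Y₁ Y₂ L Q₁ Q₂ Q₃ →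
              (Y₁ SS.:* Q₁) SS.:* ((Y₂ SS.:* Q₂) SS.:* (L SS.:* Q₃))
                SS.:= (Y₁ SS.:* (Y₂ SS.:* L)) SS.:* (Q₁ SS.:* (Q₂ SS.:* Q₃)))
            S.refl Y₁ Y₂ L Q₁ Q₂ Q₃)

    module _ (u v w : ℕ) .{{_ : NonZero u}} (2∤u : 2 ∤ u) (n : ℕ) where

      eulerSum-swapʳ : eulerSum u v w n y₁ y₂ ≈ eulerSum u w v n y₁ y₂
      eulerSum-swapʳ = begin
        eulerSum u v w n y₁ y₂
          ≈⟨ eulerSum≈symmetricSeries u v w 2∤u n ⟩
        fromℕ (n !) * symmetricSeries (fromℕ u) (fromℕ v) (fromℕ w) n
          ≈⟨ *-congˡ (symmetricSeries-swapʳ (fromℕ u) (fromℕ v) (fromℕ w) n) ⟩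
        fromℕ (n !) * symmetricSeries (fromℕ u) (fromℕ w) (fromℕ v) n
          ≈⟨ eulerSum≈symmetricSeries u w v 2∤u n ⟨
        eulerSum u w v n y₁ y₂ ∎

      -- The leading argument, which bounds the inner sum, changes from u to w. The passage through
      -- `symmetricSeries` is therefore made once with u in front and once with w, each time with
      -- its own parity.
      eulerSum-rotate : .{{_ : NonZero w}} → 2 ∤ w →
                        eulerSum u v w n y₁ y₂ ≈ eulerSum w u v n y₁ y₂
      eulerSum-rotate 2∤w = begin
        eulerSum u v w n y₁ y₂
          ≈⟨ eulerSum-swapʳ ⟩
        eulerSum u w v n y₁ y₂
          ≈⟨ eulerSum≈symmetricSeries u w v 2∤u n ⟩
        fromℕ (n !) * symmetricSeries (fromℕ u) (fromℕ w) (fromℕ v) n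
          ≈⟨ *-congˡ (symmetricSeries-swapˡ (fromℕ u) (fromℕ w) (fromℕ v) n) ⟩
        fromℕ (n !) * symmetricSeries (fromℕ w) (fromℕ u) (fromℕ v) n
          ≈⟨ eulerSum≈symmetricSeries w u v 2∤w n ⟨
        eulerSum w u v n y₁ y₂ ∎

-- The six expressions over ℂ_p.

theorem4p3 :
  ∀ {c ℓ₁ ℓ₂ c′ ℓ₁′ ℓ₂′ : Level} (p : ℕ) → Prime p → 2 ∤ p →
  (𝒞 : CompletedAlgebraicClosure p c ℓ₁ ℓ₂) →
  let open CompletedAlgebraicClosure 𝒞 in
  (𝒬 : EmbeddedAlgebraicNumbers c′ ℓ₁′ ℓ₂′ ℂ-p) →
  let open EmbeddedAlgebraicNumbers 𝒬 in
  (d : ℕ) .{{_ : NonZero d}} → 2 ∤ d →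
  (character : DirichletCharacter d ℚ̄) → DirichletCharacter.Primitive character →
  (w₁ w₂ w₃ : ℕ) .{{_ : NonZero w₁}} .{{_ : NonZero w₂}} .{{_ : NonZero w₃}} →
  2 ∤ w₁ → 2 ∤ w₂ → 2 ∤ w₃ →
  (n : ℕ) (y₁ y₂ : ℤ-p p) →
  let open HeytingField ℂ-p using (_≈_)
      χ = embedding ∘ DirichletCharacter.χ character
      open GeneralizedEuler (rawRing ℂ-p) fromℚ d χ using (eulerSum)
      Y₁ = ℤ-p→ℂ-p y₁
      Y₂ = ℤ-p→ℂ-p y₂
  in
    (eulerSum w₁ w₂ w₃ n Y₁ Y₂ ≈ eulerSum w₁ w₃ w₂ n Y₁ Y₂)
  × (eulerSum w₁ w₃ w₂ n Y₁ Y₂ ≈ eulerSum w₂ w₁ w₃ n Y₁ Y₂)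
  × (eulerSum w₂ w₁ w₃ n Y₁ Y₂ ≈ eulerSum w₂ w₃ w₁ n Y₁ Y₂)
  × (eulerSum w₂ w₃ w₁ n Y₁ Y₂ ≈ eulerSum w₃ w₁ w₂ n Y₁ Y₂)
  × (eulerSum w₃ w₁ w₂ n Y₁ Y₂ ≈ eulerSum w₃ w₂ w₁ n Y₁ Y₂)
theorem4p3 _ _ _ 𝒞 𝒬 d 2∤d character _ w₁ w₂ w₃ 2∤w₁ 2∤w₂ 2∤w₃ n y₁ y₂ =
    eulerSum-swapʳ Y₁ Y₂ w₁ w₂ w₃ 2∤w₁ n
  , eulerSum-rotate Y₁ Y₂ w₁ w₃ w₂ 2∤w₁ n 2∤w₂
  , eulerSum-swapʳ Y₁ Y₂ w₂ w₁ w₃ 2∤w₂ n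
  -- Here the first argument has to move to the end, which is the inverse of the rotation.
  , sym (eulerSum-rotate Y₁ Y₂ w₃ w₁ w₂ 2∤w₃ n 2∤w₂)
  , eulerSum-swapʳ Y₁ Y₂ w₃ w₁ w₂ 2∤w₃ n
  where
  open CompletedAlgebraicClosure 𝒞 using (ℂ-p; ℤ-p→ℂ-p)
  open EmbeddedAlgebraicNumbers 𝒬 using (embedding; isRingMonomorphism)
  open DirichletCharacter character using (χ; periodic)
  open HeytingField ℂ-p using (Carrier; sym; trans)
  module Embedding = IsRingMonomorphism isRingMonomorphism

  Y₁ Y₂ : Carrier
  Y₁ = ℤ-p→ℂ-p y₁
  Y₂ = ℤ-p→ℂ-p y₂

  [d+a]-a≡1*d : ∀ d a → (d ℤ.+ a) ℤ.- a ≡ ℤ.1ℤ ℤ.* d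
  [d+a]-a≡1*d = solve-∀

  open EulerSums
    (HeytingCommutativeRing.commutativeRing (HeytingField.heytingCommutativeRing ℂ-p))
    -- The composite ℚ → ℚ̄ → ℂ_p is a ring homomorphism, which makes ℂ_p the ℚ-algebra of the
    -- computation.
    (isRingHomomorphism trans
      (IsRingMonomorphism.isRingHomomorphism
        (IsAlgebraicClosure.isRingMonomorphism
          (EmbeddedAlgebraicNumbers.isAlgebraicClosure 𝒬)))
      Embedding.isRingHomomorphism)
    d 2∤d (embedding ∘ χ)
    (λ a → Embedding.⟦⟧-cong (periodic (+ (d ℕ.+ a)) (+ a)
      (ℤ∣.divides ℤ.1ℤ ([d+a]-a≡1*d (+ d) (+ a)))))
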